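{- Let $d\ge 4$ and $D\ge 4$ be integers and let $\Gamma$ be a $(d,D,-2)$-graph. Then the girth of $\Gamma$ is $2D$.
   Context: All graphs are simple. For integers $\Delta\ge 2$, $D\ge 1$, the Moore bound is $M(\Delta,D)=1+\Delta\left(1+(\Delta-1)+\dots+(\Delta-1)^{D-1}\right)$. For $\epsilon\ge 0$, a $(\Delta,D,-\epsilon)$-graph is a graph of maximum degree $\Delta$, diameter $D$, and order exactly $M(\Delta,D)-\epsilon$. The girth of a graph is the length of its shortest cycle. -}

module Defs where

open import Data.Nat using (ℕ; zero; suc; _+_; _*_; _∸_; _^_; _≤_; _<_)
open import Data.Fin using (Fin; zero; suc; fromℕ; inject₁)
open import Data.Bool using (Bool; true; false)
open import Data.List using (List; length; filterᵇ; allFin)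
open import Data.Product using (Σ; ∃; ∃-syntax; _×_; _,_)
open import Relation.Binary.PropositionalEquality using (_≡_; _≢_)
open import Relation.Nullary using (¬_)
open import Function.Definitions using (Injective)

record Graph (n : ℕ) : Set where
  field
    adj     : Fin n → Fin n → Bool
    adj-sym : ∀ u v → adj u v ≡ adj v u
    adj-irr : ∀ u → adj u u ≡ false
open Graph public

module _ {n : ℕ} (G : Graph n) where

  Adj : Fin n → Fin n → Set
  Adj u v = adj G u v ≡ true

  degree : Fin n → ℕ
  degree u = length (filterᵇ (adj G u) (allFin n))

  MaxDegree : ℕ → Set
  MaxDegree Δ = (∀ u → degree u ≤ Δ) × (∃[ u ] degree u ≡ Δ)

  data Walk : Fin n → Fin n → ℕ → Set where
    [] : ∀ {u} → Walk u u zero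
    _∷_ : ∀ {u v w k} → Adj u v → Walk v w k → Walk u w (suc k)

  Dist : Fin n → Fin n → ℕ → Set
  Dist u v k = Walk u v k × (∀ j → j < k → ¬ Walk u v j)

  Diameter : ℕ → Set
  Diameter D = (∀ u v → ∃[ k ] (k ≤ D × Dist u v k))
             × (∃[ u ] ∃[ v ] Dist u v D)

  Cycle : ℕ → Set
  Cycle k = 3 ≤ k × (Σ ℕ λ m → Σ (k ≡ suc m) λ { _ →
              Σ (Fin (suc m) → Fin n) λ c →
                Injective _≡_ _≡_ c
              × (∀ (i : Fin m) → Adj (c (inject₁ i)) (c (suc i)))
              × Adj (c (fromℕ m)) (c zero) })

  Girth : ℕ → Set
  Girth g = Cycle g × (∀ k → k < g → ¬ Cycle k)

geomSum : ℕ → ℕ → ℕ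
geomSum q zero    = zero
geomSum q (suc i) = geomSum q i + q ^ i

Moore : ℕ → ℕ → ℕ
Moore Δ D = 1 + Δ * geomSum (Δ ∸ 1) D

-- (Δ,D,-ε)-graph: max degree Δ, diameter D, order M(Δ,D) - ε
-- (order stated as n + ε ≡ M(Δ,D) to avoid truncated subtraction)
IsDefectGraph : ℕ → ℕ → ℕ → {n : ℕ} → Graph n → Set
IsDefectGraph Δ D ε {n} G = MaxDegree G Δ × Diameter G D × (n + ε ≡ Moore Δ D)

{-# OPTIONS --safe #-}
module Submission where

-- Write D = m + 1 and d = q + 1. Counting nonbacktracking walks shows that Γ is regular and that, apart from
-- exactly two surplus walks per starting vertex, any two vertices are joined by a unique nonbacktracking
-- walk of length at most D. Call v a repeat of u when there are at least two. A cycle of length at most 2m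
-- produces three repeats of one vertex; the real work is excluding a cycle C = (c i) of length 2m + 1 = 2D - 1.
--
-- Since the matrix counting these walks is a polynomial in the adjacency matrix A, it commutes with A, so the
-- repeats of the neighbours of u are the neighbours of the repeats of u. The repeats of c i are c (i + m) and
-- c (i + m + 1), so vertices off C have no surplus walk to C. By induction, a vertex on a branch of
-- height k ≤ m over c i has one repeat at height k over c (i + m) and one over c (i + m + 1).
-- Let y, over c 0, and its repeat g, over c m, have height 1. The two walks of length D from y to g bound a closed
-- walk of length 2D, which carries a vertex W lying at height D - 1 over c 0 and at height 3 over c m. Comparing
-- the two descriptions of its repeats yields a vertex lying both at height m over c (m + 1) and
-- at height 3 over c (2m), which thus has two walks of length D to c (m + 2): a contradiction.

open import Defs
open import Data.Nat
open import Data.Nat.Properties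
open import Data.Nat.DivMod
open import Data.Nat.Divisibility using (divides-refl; divides; ∣m+n∣m⇒∣n; >⇒∤)
open import Data.Nat.Induction using (<-rec)
open import Data.Nat.Tactic.RingSolver using (solve-∀)
open import Data.Fin using (Fin; zero; suc; toℕ; fromℕ; inject₁)
open import Data.Fin.Properties using (any?; toℕ-injective; toℕ-fromℕ; toℕ-fromℕ<; toℕ-inject₁; toℕ<n)
  renaming (_≟_ to _≟ᶠ_)
open import Data.Bool using (Bool; true; false; if_then_else_)
import Data.Bool.Properties as Bool
open import Data.List using (List; []; _∷_; _∷ʳ_; length; filterᵇ; tabulate)
open import Data.List.Properties using (∷-injectiveˡ; ∷-injectiveʳ; ≡-dec)
open import Data.Product using (Σ; ∃-syntax; ∃₂; _×_; _,_; proj₁; proj₂)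
open import Data.Sum using (_⊎_; inj₁; inj₂)
open import Data.Empty using (⊥; ⊥-elim)
open import Function using (_∘_; id)
open import Relation.Binary.Definitions using (tri<; tri≈; tri>)
open import Relation.Binary.PropositionalEquality
open import Relation.Nullary using (¬_; yes; no; does; contradiction)
open import Relation.Nullary.Decidable using (_×-dec_; ¬?)
open import Algebra.Properties.Semiring.Sum +-*-semiring
  using (sum; sum-cong-≗; ∑-distrib-+; ∑-comm; *-distribˡ-sum; *-distribʳ-sum; sum-replicate-zero)

-- Finite sums

-- The relation is a parameter because totals are later compared both by `_≤_` and by `_≡_`.
sum-preserves : (_∼_ : ℕ → ℕ → Set) → 0 ∼ 0 →
  (∀ {a b c d} → a ∼ b → c ∼ d → (a + c) ∼ (b + d)) →
  ∀ {n} {f g : Fin n → ℕ} → (∀ x → f x ∼ g x) → sum f ∼ sum g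
sum-preserves _ z _ {zero} h = z
sum-preserves R z p {suc n} h = p (h zero) (sum-preserves R z p (h ∘ suc))

sum-mono-≤ : ∀ {n} {f g : Fin n → ℕ} → (∀ x → f x ≤ g x) → sum f ≤ sum g
sum-mono-≤ = sum-preserves _≤_ z≤n +-mono-≤

sum-ones : ∀ n → sum {n} (λ _ → 1) ≡ n
sum-ones zero    = refl
sum-ones (suc n) = cong suc (sum-ones n)

term≤sum : ∀ {n} (f : Fin n → ℕ) x → f x ≤ sum f
term≤sum f zero    = m≤m+n _ _
term≤sum f (suc x) = ≤-trans (term≤sum (f ∘ suc) x) (m≤n+m _ _)

two-terms≤sum : ∀ {n} (f : Fin n → ℕ) {x y} → x ≢ y → f x + f y ≤ sum f
two-terms≤sum f {zero}  {zero}  x≢y = contradiction refl x≢y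
two-terms≤sum f {zero}  {suc y} x≢y = +-monoʳ-≤ (f zero) (term≤sum (f ∘ suc) y)
two-terms≤sum f {suc x} {zero}  x≢y =
  subst (_≤ sum f) (+-comm (f zero) _) (+-monoʳ-≤ (f zero) (term≤sum (f ∘ suc) x))
two-terms≤sum f {suc x} {suc y} x≢y =
  ≤-trans (two-terms≤sum (f ∘ suc) (x≢y ∘ cong suc)) (m≤n+m _ _)

positive-term : ∀ {n} (f : Fin n → ℕ) → 1 ≤ sum f → ∃[ x ] 1 ≤ f x
positive-term {suc n} f p with f zero in eq
... | suc a = zero , subst (1 ≤_) (sym eq) (s≤s z≤n)
... | zero with positive-term (f ∘ suc) p
...   | x , q = suc x , q

large-term-or-two-positive : ∀ {n} (f : Fin n → ℕ) → 2 ≤ sum f →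
  (∃[ x ] 2 ≤ f x) ⊎ (∃₂ λ x y → x ≢ y × 1 ≤ f x × 1 ≤ f y)
large-term-or-two-positive {suc n} f p with f zero in eq
... | suc (suc a) = inj₁ (zero , subst (2 ≤_) (sym eq) (s≤s (s≤s z≤n)))
... | suc zero with positive-term (f ∘ suc) (s≤s⁻¹ p)
...   | x , q = inj₂ (zero , suc x , (λ ()) , subst (1 ≤_) (sym eq) ≤-refl , q)
large-term-or-two-positive {suc n} f p | zero with large-term-or-two-positive (f ∘ suc) p
... | inj₁ (x , q) = inj₁ (suc x , q)
... | inj₂ (x , y , x≢y , q , r) = inj₂ (suc x , suc y , (λ { refl → x≢y refl }) , q , r)

δ : ∀ {n} → Fin n → Fin n → ℕ
δ u v = if does (u ≟ᶠ v) then 1 else 0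

δ-refl : ∀ {n} (u : Fin n) → δ u u ≡ 1
δ-refl zero    = refl
δ-refl (suc u) = δ-refl u

δ-positive : ∀ {n} {u v : Fin n} → 1 ≤ δ u v → u ≡ v
δ-positive {u = u} {v} p with u ≟ᶠ v
... | yes u≡v = u≡v

δ≤1 : ∀ {n} (u v : Fin n) → δ u v ≤ 1
δ≤1 u v with u ≟ᶠ v
... | yes _ = ≤-refl
... | no  _ = z≤n

δ-sym : ∀ {n} (u v : Fin n) → δ u v ≡ δ v u
δ-sym zero    zero    = refl
δ-sym zero    (suc v) = refl
δ-sym (suc u) zero    = refl
δ-sym (suc u) (suc v) = δ-sym u v

sum-δ-* : ∀ {n} (u : Fin n) (f : Fin n → ℕ) → sum (λ x → δ u x * f x) ≡ f u
sum-δ-* {suc n} zero    f = trans (cong₂ _+_ (*-identityˡ (f zero)) (sum-replicate-zero n)) (+-identityʳ _)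
sum-δ-* {suc n} (suc u) f = sum-δ-* u (f ∘ suc)

sum-δ : ∀ {n} (u : Fin n) → sum (δ u) ≡ 1
sum-δ u = trans (sum-cong-≗ (λ x → sym (*-identityʳ (δ u x)))) (sum-δ-* u (λ _ → 1))

sum-three-δ : ∀ {n} (x y z : Fin n) → sum (λ v → δ x v + δ y v + δ z v) ≡ 3
sum-three-δ x y z = trans (∑-distrib-+ (λ v → δ x v + δ y v) (δ z))
  (cong₂ _+_ (trans (∑-distrib-+ (δ x) (δ y)) (cong₂ _+_ (sum-δ x) (sum-δ y))) (sum-δ z))

three-δ≤1 : ∀ {n} {x y z : Fin n} → x ≢ y → x ≢ z → y ≢ z → ∀ v → δ x v + δ y v + δ z v ≤ 1
three-δ≤1 {x = x} {y} {z} x≢y x≢z y≢z v with x ≟ᶠ v | y ≟ᶠ v | z ≟ᶠ v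
... | yes refl | yes refl | _        = contradiction refl x≢y
... | yes refl | no _     | yes refl = contradiction refl x≢z
... | no _     | yes refl | yes refl = contradiction refl y≢z
... | yes _    | no _     | no _     = ≤-refl
... | no _     | yes _    | no _     = ≤-refl
... | no _     | no _     | yes _    = ≤-refl
... | no _     | no _     | no _     = z≤n

indicator : Bool → ℕ
indicator b = if b then 1 else 0

sum-indicator : ∀ {n} {a} {X : Set a} (p : X → Bool) (f : Fin n → X) →
  length (filterᵇ p (tabulate f)) ≡ sum (indicator ∘ p ∘ f)
sum-indicator {zero}  p f = refl
sum-indicator {suc n} p f with p (f zero)
... | true  = cong suc (sum-indicator p (f ∘ suc))
... | false = sum-indicator p (f ∘ suc)

-- `geomSum` adds the top power last, whereas counting walks by their first step produces the Horner
-- form.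
geomSum-step : ∀ q i → 1 + q * geomSum q i ≡ geomSum q (suc i)
geomSum-step q zero    = cong suc (*-zeroʳ q)
geomSum-step q (suc i) = begin
  1 + q * (geomSum q i + q ^ i)        ≡⟨ cong suc (*-distribˡ-+ q (geomSum q i) (q ^ i)) ⟩
  (1 + q * geomSum q i) + q * q ^ i    ≡⟨ cong (_+ q * q ^ i) (geomSum-step q i) ⟩
  geomSum q (suc i) + q ^ suc i        ∎
  where open ≡-Reasoning

-- Nonbacktracking walks and their number

module Walks {n : ℕ} (G : Graph n) where

  V : Set
  V = Fin n

  _~_ : V → V → Set
  u ~ v = Adj G u v

  ~-sym : ∀ {u v} → u ~ v → v ~ u
  ~-sym {u} {v} uv = trans (adj-sym G v u) uv

  ~⇒≢ : ∀ {u v} → u ~ v → u ≢ v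
  ~⇒≢ {u} uu refl with trans (sym uu) (adj-irr G u)
  ... | ()

  -- A nonbacktracking walk from u to v whose first step does not go to p; taking p = u imposes nothing.
  data NB (p : V) : V → V → ℕ → Set where
    []   : ∀ {u} → NB p u u 0
    step : ∀ {u x v k} → u ~ x → x ≢ p → NB u x v k → NB p u v (suc k)

  -- Walks of different lengths or with different avoided vertices have different types; their codes
  -- are lists and can be compared.
  code : ∀ {p u v k} → NB p u v k → List V
  code []                 = []
  code (step {x = x} _ _ w) = x ∷ code w

  length-code : ∀ {p u v k} (w : NB p u v k) → length (code w) ≡ k
  length-code []           = refl
  length-code (step _ _ w) = cong suc (length-code w)

  length-differ : ∀ {p q u v u′ v′ k l} (w : NB p u v k) (w′ : NB q u′ v′ l) → k ≢ l → code w ≢ code w′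
  length-differ w w′ k≢l eq =
    k≢l (trans (sym (length-code w)) (trans (cong length eq) (length-code w′)))

  forget : ∀ {p u v k} → NB p u v k → NB u u v k
  forget []             = []
  forget (step uv _ w)  = step uv (≢-sym (~⇒≢ uv)) w

  code-forget : ∀ {p u v k} (w : NB p u v k) → code (forget w) ≡ code w
  code-forget []           = refl
  code-forget (step _ _ w) = refl

  A : V → V → ℕ
  A u v = indicator (adj G u v)

  A-sym : ∀ u v → A u v ≡ A v u
  A-sym u v = cong indicator (adj-sym G u v)

  A-~ : ∀ {u v} → u ~ v → A u v ≡ 1
  A-~ uv = cong indicator uv

  degree≡ΣA : ∀ u → degree G u ≡ sum (A u)
  degree≡ΣA u = sum-indicator (adj G u) id

  ν : V → V → ℕ
  ν p x = if does (p ≟ᶠ x) then 0 else 1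

  ν+δ≡1 : ∀ p x → ν p x + δ p x ≡ 1
  ν+δ≡1 p x with p ≟ᶠ x
  ... | yes _ = refl
  ... | no  _ = refl

  -- The number of nonbacktracking walks of length at most k from u to v whose first step avoids p.
  T : ℕ → V → V → V → ℕ
  T zero    p u v = δ u v
  T (suc k) p u v = δ u v + sum (λ x → A u x * (ν p x * T k u x v))

  P : ℕ → V → V → ℕ
  P k u v = T k u u v

  allowed-term : ∀ {p u x} → u ~ x → x ≢ p → ∀ t → A u x * (ν p x * t) ≡ t
  allowed-term {p} {u} {x} ux x≢p t with adj G u x | p ≟ᶠ x
  allowed-term () _ _ | false | _
  ... | true | yes p≡x = contradiction (sym p≡x) x≢p
  ... | true | no _ = trans (*-identityˡ _) (*-identityˡ t)

  positive⇒allowed : ∀ {p u x t} → 1 ≤ A u x * (ν p x * t) → u ~ x × x ≢ p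
  positive⇒allowed {p} {u} {x} h with adj G u x | p ≟ᶠ x
  ... | true | no p≢x = refl , ≢-sym p≢x

  1≤T : ∀ {k p u v a} → NB p u v a → a ≤ k → 1 ≤ T k p u v
  1≤T {zero}  {u = u} [] _ = ≤-reflexive (sym (δ-refl u))
  1≤T {suc k} {u = u} [] _ = ≤-trans (≤-reflexive (sym (δ-refl u))) (m≤m+n _ _)
  1≤T {suc k} {p} {u} {v} (step {x = x} ux x≢p w) (s≤s a≤k) = begin
    1                                               ≤⟨ 1≤T w a≤k ⟩
    T k u x v                                       ≡⟨ allowed-term ux x≢p _ ⟨
    A u x * (ν p x * T k u x v)                     ≤⟨ term≤sum (λ y → A u y * (ν p y * T k u y v)) x ⟩
    sum (λ y → A u y * (ν p y * T k u y v))         ≤⟨ m≤n+m _ _ ⟩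
    T (suc k) p u v                                 ∎
    where open ≤-Reasoning

  closed⇒2≤T : ∀ {k p u a} → NB p u u (suc a) → suc a ≤ k → 2 ≤ T k p u u
  closed⇒2≤T {suc k} {p} {u} (step {x = x} ux x≢p w) (s≤s a≤k) =
    +-mono-≤ (≤-reflexive (sym (δ-refl u)))
      (≤-trans (≤-trans (1≤T w a≤k) (≤-reflexive (sym (allowed-term ux x≢p _))))
               (term≤sum (λ y → A u y * (ν p y * T k u y u)) x))

  -- Walks with a common first step count within one summand, by induction; otherwise two distinct
  -- summands are positive. An empty walk is counted by `δ`.
  2≤T : ∀ {k p u v a b} (w : NB p u v a) (w′ : NB p u v b) → code w ≢ code w′ →
        a ≤ k → b ≤ k → 2 ≤ T k p u v
  2≤T []            []            ne _ _ = contradiction refl ne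
  2≤T []            w′@(step _ _ _) ne _ b≤k = closed⇒2≤T w′ b≤k
  2≤T w@(step _ _ _) []           ne a≤k _ = closed⇒2≤T w a≤k
  2≤T {suc k} {p} {u} {v} (step {x = x} ux x≢p w) (step {x = y} uy y≢p w′) ne (s≤s a≤k) (s≤s b≤k)
    with x ≟ᶠ y
  ... | yes refl = begin
    2                            ≤⟨ 2≤T w w′ (ne ∘ cong (x ∷_)) a≤k b≤k ⟩
    T k u x v                    ≡⟨ allowed-term ux x≢p _ ⟨
    A u x * (ν p x * T k u x v)  ≤⟨ term≤sum (λ z → A u z * (ν p z * T k u z v)) x ⟩
    _                            ≤⟨ m≤n+m _ _ ⟩
    T (suc k) p u v              ∎
    where open ≤-Reasoning
  ... | no x≢y = begin
    1 + 1                        ≤⟨ +-mono-≤ (1≤T w a≤k) (1≤T w′ b≤k) ⟩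
    T k u x v + T k u y v        ≡⟨ cong₂ _+_ (allowed-term ux x≢p _) (allowed-term uy y≢p _) ⟨
    A u x * (ν p x * T k u x v) + A u y * (ν p y * T k u y v)
                                 ≤⟨ two-terms≤sum (λ z → A u z * (ν p z * T k u z v)) x≢y ⟩
    _                            ≤⟨ m≤n+m _ _ ⟩
    T (suc k) p u v              ∎
    where open ≤-Reasoning

  1≤T⇒walk : ∀ {k p u v} → 1 ≤ T k p u v → ∃[ a ] a ≤ k × NB p u v a
  1≤T⇒walk {zero} {u = u} {v} h with refl ← δ-positive {u = u} {v} h = 0 , z≤n , []
  1≤T⇒walk {suc k} {p} {u} {v} h with u ≟ᶠ v
  ... | yes refl = 0 , z≤n , []
  ... | no  _ with positive-term _ h
  ...   | x , h′ with positive⇒allowed {p} {u} {x} h′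
  ...     | ux , x≢p with 1≤T⇒walk {k} (subst (1 ≤_) (allowed-term ux x≢p _) h′)
  ...       | a , a≤k , w = suc a , s≤s a≤k , step ux x≢p w

  TwoWalks : ℕ → V → V → V → Set
  TwoWalks k p u v = ∃₂ λ a b → Σ (NB p u v a) λ w → Σ (NB p u v b) λ w′ →
    a ≤ k × b ≤ k × code w ≢ code w′

  2≤T⇒two-walks : ∀ {k p u v} → 2 ≤ T k p u v → TwoWalks k p u v
  2≤T⇒two-walks {zero} {u = u} {v} h = contradiction (≤-trans h (δ≤1 u v)) λ { (s≤s ()) }
  2≤T⇒two-walks {suc k} {p} {u} {v} h with u ≟ᶠ v
  2≤T⇒two-walks {suc k} {p} {u} {v} h | yes refl with positive-term _ (s≤s⁻¹ h)
  ... | x , h′ with positive⇒allowed {p} {u} {x} h′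
  ...   | ux , x≢p with 1≤T⇒walk {k} (subst (1 ≤_) (allowed-term ux x≢p _) h′)
  ...     | a , a≤k , w = 0 , suc a , [] , step ux x≢p w , z≤n , s≤s a≤k , λ ()
  2≤T⇒two-walks {suc k} {p} {u} {v} h | no _ with large-term-or-two-positive _ h
  ... | inj₁ (x , h′) with positive⇒allowed {p} {u} {x} (≤-trans (s≤s z≤n) h′)
  ...   | ux , x≢p with 2≤T⇒two-walks {k} (subst (2 ≤_) (allowed-term ux x≢p _) h′)
  ...     | a , b , w , w′ , a≤k , b≤k , ne =
    suc a , suc b , step ux x≢p w , step ux x≢p w′ , s≤s a≤k , s≤s b≤k , ne ∘ ∷-injectiveʳ
  2≤T⇒two-walks {suc k} {p} {u} {v} h | no _
      | inj₂ (x , y , x≢y , hx , hy) with positive⇒allowed {p} {u} {x} hx | positive⇒allowed {p} {u} {y} hy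
  ... | ux , x≢p | uy , y≢p
      with 1≤T⇒walk {k} (subst (1 ≤_) (allowed-term ux x≢p _) hx)
         | 1≤T⇒walk {k} (subst (1 ≤_) (allowed-term uy y≢p _) hy)
  ...   | a , a≤k , w | b , b≤k , w′ =
    suc a , suc b , step ux x≢p w , step uy y≢p w′ , s≤s a≤k , s≤s b≤k , x≢y ∘ ∷-injectiveˡ

  -- Prepend an edge to the reduced tail; if the tail starts by returning, the two steps cancel.
  nonbacktracking : ∀ {u v k} → Walk G u v k → ∃[ a ] a ≤ k × NB u u v a
  nonbacktracking [] = 0 , z≤n , []
  nonbacktracking {u} (_∷_ {v = x} ux w) with nonbacktracking w
  ... | _ , _   , [] = 1 , s≤s z≤n , step ux (≢-sym (~⇒≢ ux)) []
  ... | suc a , a≤k , w′@(step {x = y} xy y≢x w″) with y ≟ᶠ u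
  ...   | yes refl = a , ≤-trans (n≤1+n a) (≤-trans a≤k (n≤1+n _)) , forget w″
  ...   | no  y≢u  = suc (suc a) , s≤s a≤k , step ux (≢-sym (~⇒≢ ux)) (step xy y≢u w″)

-- Counting nonbacktracking walks by their first step

module Counting {n : ℕ} (G : Graph n) where
  open Walks G

  A*ν-self : ∀ u x t → A u x * (ν u x * t) ≡ A u x * t
  A*ν-self u x t with adj G u x in eq | u ≟ᶠ x
  ... | false | _        = refl
  ... | true  | no _     = cong (_+ 0) (+-identityʳ t)
  ... | true  | yes refl = contradiction refl (~⇒≢ eq)

  P-suc : ∀ k u v → P (suc k) u v ≡ δ u v + sum (λ x → A u x * T k u x v)
  P-suc k u v = cong (δ u v +_) (sum-cong-≗ (λ x → A*ν-self u x (T k u x v)))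

  -- The second summand counts the walks that step to `p` first: what remains starts at `p` and must
  -- not return to `u`.
  split-first-step : ∀ k {u p} v → u ~ p → P (suc k) u v ≡ T (suc k) p u v + T k u p v
  split-first-step k {u} {p} v up = begin
    P (suc k) u v                               ≡⟨ P-suc k u v ⟩
    δ u v + sum (λ x → A u x * t x)             ≡⟨ cong (δ u v +_) (sum-cong-≗ decompose) ⟩
    δ u v + sum (λ x → A u x * (ν p x * t x) + δ p x * (A u x * t x))
      ≡⟨ cong (δ u v +_) (∑-distrib-+ (λ x → A u x * (ν p x * t x)) (λ x → δ p x * (A u x * t x))) ⟩
    δ u v + (sum (λ x → A u x * (ν p x * t x)) + sum (λ x → δ p x * (A u x * t x)))
      ≡⟨ +-assoc (δ u v) _ _ ⟨
    T (suc k) p u v + sum (λ x → δ p x * (A u x * t x))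
      ≡⟨ cong (T (suc k) p u v +_) (sum-δ-* p (λ x → A u x * t x)) ⟩
    T (suc k) p u v + A u p * t p
      ≡⟨ cong (λ a → T (suc k) p u v + a * t p) (A-~ up) ⟩
    T (suc k) p u v + 1 * t p                   ≡⟨ cong (T (suc k) p u v +_) (*-identityˡ (t p)) ⟩
    T (suc k) p u v + T k u p v                 ∎
    where
    open ≡-Reasoning
    t : V → ℕ
    t x = T k u x v
    rearrange : ∀ a b c t → a * (b * t) + c * (a * t) ≡ (b + c) * (a * t)
    rearrange = solve-∀
    decompose : ∀ x → A u x * t x ≡ A u x * (ν p x * t x) + δ p x * (A u x * t x)
    decompose x = sym (trans (rearrange (A u x) (ν p x) (δ p x) (t x))
      (trans (cong (_* (A u x * t x)) (ν+δ≡1 p x)) (*-identityˡ _)))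

  A-weighted : ∀ {u} {f g : V → ℕ} → (∀ {x} → u ~ x → f x ≡ g x) → ∀ x → A u x * f x ≡ A u x * g x
  A-weighted {u} h x with adj G u x in eq
  ... | true  = cong (1 *_) (h eq)
  ... | false = refl

  total : ℕ → V → V → ℕ
  total k p u = sum (T k p u)

  total-suc : ∀ k p u → total (suc k) p u ≡ 1 + sum (λ x → A u x * (ν p x * total k u x))
  total-suc k p u = begin
    sum (λ v → δ u v + sum (λ x → term x v))
      ≡⟨ ∑-distrib-+ (δ u) (λ v → sum (λ x → term x v)) ⟩
    sum (δ u) + sum (λ v → sum (λ x → term x v))
      ≡⟨ cong₂ _+_ (sum-δ u) (∑-comm (λ v x → term x v)) ⟩
    1 + sum (λ x → sum (λ v → A u x * (ν p x * T k u x v)))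
      ≡⟨ cong suc (sum-cong-≗ λ x → sym (trans
           (cong (A u x *_) (*-distribˡ-sum (ν p x) (T k u x)))
           (*-distribˡ-sum (A u x) (λ v → ν p x * T k u x v)))) ⟩
    1 + sum (λ x → A u x * (ν p x * total k u x)) ∎
    where
    open ≡-Reasoning
    term : V → V → ℕ
    term x v = A u x * (ν p x * T k u x v)

  Σν : ∀ {u p} → u ~ p → degree G u ≡ suc (sum (λ x → A u x * ν p x))
  Σν {u} {p} up = begin
    degree G u                               ≡⟨ degree≡ΣA u ⟩
    sum (A u)                                ≡⟨ sum-cong-≗ decompose ⟩
    sum (λ x → δ p x * A u x + A u x * ν p x)
      ≡⟨ ∑-distrib-+ (λ x → δ p x * A u x) (λ x → A u x * ν p x) ⟩
    sum (λ x → δ p x * A u x) + sum (λ x → A u x * ν p x)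
      ≡⟨ cong (_+ sum (λ x → A u x * ν p x)) (trans (sum-δ-* p (A u)) (A-~ up)) ⟩
    suc (sum (λ x → A u x * ν p x)) ∎
    where
    open ≡-Reasoning
    rearrange : ∀ a b c → c * a + a * b ≡ (b + c) * a
    rearrange = solve-∀
    decompose : ∀ x → A u x ≡ δ p x * A u x + A u x * ν p x
    decompose x = sym (trans (rearrange (A u x) (ν p x) (δ p x))
      (trans (cong (_* A u x) (ν+δ≡1 p x)) (*-identityˡ _)))

  -- With `_≤_` this yields the Moore bound for degrees at most q + 1; with `_≡_`, the exact number
  -- of walks in a regular graph.
  module Totals (_∼_ : ℕ → ℕ → Set) (∼-refl : ∀ {a} → a ∼ a)
    (∼-trans : ∀ {a b c} → a ∼ b → b ∼ c → a ∼ c)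
    (+-mono : ∀ {a b c d} → a ∼ b → c ∼ d → (a + c) ∼ (b + d))
    (*-mono : ∀ {a b c d} → a ∼ b → c ∼ d → (a * c) ∼ (b * d))
    (suc⁻ : ∀ {a b} → suc a ∼ suc b → a ∼ b) where

    A-weighted-∼ : ∀ {u} {f g : V → ℕ} → (∀ {x} → u ~ x → f x ∼ g x) → ∀ x → (A u x * f x) ∼ (A u x * g x)
    A-weighted-∼ {u} h x with adj G u x in eq
    ... | true  = *-mono (∼-refl {1}) (h eq)
    ... | false = ∼-refl {0}

    module _ {q : ℕ} (deg : ∀ u → degree G u ∼ suc q) where

      total-∼ : ∀ k {p u} → u ~ p → total k p u ∼ geomSum q (suc k)
      total-∼ zero {p} {u} up = subst (_∼ geomSum q 1) (sym (sum-δ u)) ∼-refl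
      total-∼ (suc k) {p} {u} up =
        subst₂ _∼_ (sym (total-suc k p u)) (geomSum-step q (suc k))
          (+-mono ∼-refl (∼-trans termwise (*-mono branches ∼-refl)))
        where
        g : ℕ
        g = geomSum q (suc k)
        branches : sum (λ x → A u x * ν p x) ∼ q
        branches = suc⁻ (subst (_∼ suc q) (Σν up) (deg u))
        termwise : sum (λ x → A u x * (ν p x * total k u x)) ∼ (sum (λ x → A u x * ν p x) * g)
        termwise = subst (sum (λ x → A u x * (ν p x * total k u x)) ∼_)
          (sym (trans (*-distribʳ-sum g (λ x → A u x * ν p x))
                      (sum-cong-≗ (λ x → *-assoc (A u x) (ν p x) g))))
          (sum-preserves _∼_ ∼-refl +-mono
            (A-weighted-∼ (λ {x} ux → *-mono (∼-refl {ν p x}) (total-∼ k (~-sym ux)))))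

      root-total-∼ : ∀ k u → total (suc k) u u ∼ (1 + degree G u * geomSum q (suc k))
      root-total-∼ k u = subst₂ _∼_ (sym lhs) (cong suc rhs)
        (+-mono ∼-refl (sum-preserves _∼_ ∼-refl +-mono
          (A-weighted-∼ (λ {x} ux → total-∼ k (~-sym ux)))))
        where
        g : ℕ
        g = geomSum q (suc k)
        lhs : total (suc k) u u ≡ 1 + sum (λ x → A u x * total k u x)
        lhs = trans (total-suc k u u) (cong suc (sum-cong-≗ (λ x → A*ν-self u x (total k u x))))
        rhs : sum (λ x → A u x * g) ≡ degree G u * g
        rhs = sym (trans (cong (_* g) (degree≡ΣA u)) (*-distribʳ-sum g (A u)))

  -- The walk-counting matrices of a regular graph

  module Regular (q : ℕ) (regular : ∀ u → degree G u ≡ suc q) where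

    ΣA : ∀ u → sum (A u) ≡ suc q
    ΣA u = trans (sym (degree≡ΣA u)) (regular u)

    ΣAᵀ : ∀ v → sum (λ x → A x v) ≡ suc q
    ΣAᵀ v = trans (sum-cong-≗ (λ x → A-sym x v)) (ΣA v)

    ΣA* : ∀ u t → sum (λ x → A u x * t) ≡ suc q * t
    ΣA* u t = trans (sym (*-distribʳ-sum t (A u))) (cong (_* t) (ΣA u))

    -- A walk from `u` is counted once for each neighbour of `u` that is not its first step: the
    -- empty walk q + 1 times, every other walk q times.
    returning : ∀ k u v → sum (λ x → A u x * T k x u v) ≡ δ u v + q * P k u v
    returning zero    u v = ΣA* u (δ u v)
    returning (suc k) u v = +-cancelʳ-≡ S _ _ (begin
      sum (λ x → A u x * T (suc k) x u v) + S
        ≡⟨ ∑-distrib-+ (λ x → A u x * T (suc k) x u v) (λ x → A u x * T k u x v) ⟨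
      sum (λ x → A u x * T (suc k) x u v + A u x * T k u x v)
        ≡⟨ sum-cong-≗ (λ x → *-distribˡ-+ (A u x) _ _) ⟨
      sum (λ x → A u x * (T (suc k) x u v + T k u x v))
        ≡⟨ sum-cong-≗ (A-weighted (split-first-step k v)) ⟨
      sum (λ x → A u x * p)       ≡⟨ ΣA* u p ⟩
      p + q * p                   ≡⟨ cong (_+ q * p) (P-suc k u v) ⟩
      δ u v + S + q * p           ≡⟨ swap (δ u v) S (q * p) ⟩
      δ u v + q * p + S           ∎)
      where
      open ≡-Reasoning
      S p : ℕ
      S = sum (λ x → A u x * T k u x v)
      p = P (suc k) u v
      swap : ∀ a b c → a + b + c ≡ a + c + b
      swap = solve-∀

    AP PA : ℕ → V → V → ℕ
    AP k u v = sum (λ x → A u x * P k x v)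
    PA k u v = sum (λ x → P k u x * A x v)

    -- After an edge from `u`, a nonbacktracking walk either stays away from `u` at its first step
    -- or goes back to it, and the latter are counted by `returning`. This three-term recurrence
    -- makes `P k` a polynomial in the adjacency matrix.
    recurrence : ∀ k u v → AP (suc k) u v ≡ P (2 + k) u v + q * P k u v
    recurrence k u v = begin
      sum (λ x → A u x * P (suc k) x v)
        ≡⟨ sum-cong-≗ (A-weighted (λ ux → split-first-step k v (~-sym ux))) ⟩
      sum (λ x → A u x * (T (suc k) u x v + T k x u v))
        ≡⟨ sum-cong-≗ (λ x → *-distribˡ-+ (A u x) _ _) ⟩
      sum (λ x → A u x * T (suc k) u x v + A u x * T k x u v)
        ≡⟨ ∑-distrib-+ (λ x → A u x * T (suc k) u x v) (λ x → A u x * T k x u v) ⟩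
      S + sum (λ x → A u x * T k x u v)   ≡⟨ cong (S +_) (returning k u v) ⟩
      S + (δ u v + q * P k u v)           ≡⟨ swap S (δ u v) (q * P k u v) ⟩
      δ u v + S + q * P k u v             ≡⟨ cong (_+ q * P k u v) (P-suc (suc k) u v) ⟨
      P (2 + k) u v + q * P k u v         ∎
      where
      open ≡-Reasoning
      S : ℕ
      S = sum (λ x → A u x * T (suc k) u x v)
      swap : ∀ a b c → a + (b + c) ≡ b + a + c
      swap = solve-∀

    sum-*-δ : ∀ v (f : V → ℕ) → sum (λ x → f x * δ x v) ≡ f v
    sum-*-δ v f = trans (sum-cong-≗ (λ x → trans (*-comm (f x) (δ x v)) (cong (_* f x) (δ-sym x v))))
                        (sum-δ-* v f)

    P-one : ∀ u v → P 1 u v ≡ δ u v + A u v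
    P-one u v = trans (P-suc 0 u v) (cong (δ u v +_) (sum-*-δ v (A u)))

    -- Induction along the recurrence, with `q * AP k u v` added on both sides in place of a
    -- subtraction.
    commute : ∀ k u v → AP k u v ≡ PA k u v
    commute 0 u v = trans (sum-*-δ v (A u)) (sym (sum-δ-* u (λ x → A x v)))
    commute 1 u v = begin
      sum (λ x → A u x * P 1 x v)
        ≡⟨ sum-cong-≗ (λ x → trans (cong (A u x *_) (P-one x v)) (*-distribˡ-+ (A u x) _ _)) ⟩
      sum (λ x → A u x * δ x v + A u x * A x v)
        ≡⟨ ∑-distrib-+ (λ x → A u x * δ x v) (λ x → A u x * A x v) ⟩
      sum (λ x → A u x * δ x v) + sum (λ x → A u x * A x v)
        ≡⟨ cong (_+ sum (λ x → A u x * A x v)) (commute 0 u v) ⟩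
      sum (λ x → δ u x * A x v) + sum (λ x → A u x * A x v)
        ≡⟨ ∑-distrib-+ (λ x → δ u x * A x v) (λ x → A u x * A x v) ⟨
      sum (λ x → δ u x * A x v + A u x * A x v)
        ≡⟨ sum-cong-≗ (λ x → trans (cong (_* A x v) (P-one u x)) (*-distribʳ-+ (A x v) (δ u x) _)) ⟨
      sum (λ x → P 1 u x * A x v) ∎
      where open ≡-Reasoning
    commute (suc (suc k)) u v = +-cancelʳ-≡ (q * AP k u v) _ _ (begin
      AP (2 + k) u v + q * AP k u v
        ≡⟨ cong (AP (2 + k) u v +_) (trans (*-distribˡ-sum q (λ x → A u x * P k x v))
             (sum-cong-≗ (λ x → exchange q (A u x) (P k x v)))) ⟩
      AP (2 + k) u v + sum (λ x → A u x * (q * P k x v))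
        ≡⟨ ∑-distrib-+ (λ x → A u x * P (2 + k) x v) (λ x → A u x * (q * P k x v)) ⟨
      sum (λ x → A u x * P (2 + k) x v + A u x * (q * P k x v))
        ≡⟨ sum-cong-≗ (λ x → trans (sym (*-distribˡ-+ (A u x) (P (2 + k) x v) (q * P k x v)))
             (cong (A u x *_) (trans (sym (recurrence k x v)) (commute (suc k) x v)))) ⟩
      sum (λ x → A u x * PA (suc k) x v)
        ≡⟨ sum-cong-≗ (λ x → *-distribˡ-sum (A u x) (λ y → P (suc k) x y * A y v)) ⟩
      sum (λ x → sum (λ y → A u x * (P (suc k) x y * A y v)))
        ≡⟨ ∑-comm (λ x y → A u x * (P (suc k) x y * A y v)) ⟩
      sum (λ y → sum (λ x → A u x * (P (suc k) x y * A y v)))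
        ≡⟨ sum-cong-≗ (λ y → trans (*-distribʳ-sum (A y v) (λ x → A u x * P (suc k) x y))
             (sum-cong-≗ (λ x → *-assoc (A u x) (P (suc k) x y) (A y v)))) ⟨
      sum (λ y → AP (suc k) u y * A y v)
        ≡⟨ sum-cong-≗ (λ y → trans (cong (_* A y v) (recurrence k u y))
             (trans (*-distribʳ-+ (A y v) (P (2 + k) u y) (q * P k u y))
                    (cong (P (2 + k) u y * A y v +_) (*-assoc q (P k u y) (A y v))))) ⟩
      sum (λ y → P (2 + k) u y * A y v + q * (P k u y * A y v))
        ≡⟨ ∑-distrib-+ (λ y → P (2 + k) u y * A y v) (λ y → q * (P k u y * A y v)) ⟩
      PA (2 + k) u v + sum (λ y → q * (P k u y * A y v))
        ≡⟨ cong (PA (2 + k) u v +_) (*-distribˡ-sum q (λ y → P k u y * A y v)) ⟨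
      PA (2 + k) u v + q * PA k u v
        ≡⟨ cong (λ s → PA (2 + k) u v + q * s) (commute k u v) ⟨
      PA (2 + k) u v + q * AP k u v ∎)
      where
      open ≡-Reasoning
      exchange : ∀ a b c → a * (b * c) ≡ b * (a * c)
      exchange = solve-∀

    -- Transposes the recurrence, using that `P (suc k)` commutes with the adjacency matrix. It
    -- makes being a repeat a symmetric relation.
    P-sym : ∀ k u v → P k u v ≡ P k v u
    P-sym 0 u v = δ-sym u v
    P-sym 1 u v = trans (P-one u v) (trans (cong₂ _+_ (δ-sym u v) (A-sym u v)) (sym (P-one v u)))
    P-sym (suc (suc k)) u v = +-cancelʳ-≡ (q * P k u v) _ _ (begin
      P (2 + k) u v + q * P k u v          ≡⟨ recurrence k u v ⟨
      AP (suc k) u v                       ≡⟨ commute (suc k) u v ⟩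
      sum (λ x → P (suc k) u x * A x v)
        ≡⟨ sum-cong-≗ (λ x → trans (cong₂ _*_ (P-sym (suc k) u x) (A-sym x v)) (*-comm (P (suc k) x u) (A v x))) ⟩
      AP (suc k) v u                       ≡⟨ recurrence k v u ⟩
      P (2 + k) v u + q * P k v u          ≡⟨ cong (λ s → P (2 + k) v u + q * s) (P-sym k u v) ⟨
      P (2 + k) v u + q * P k u v          ∎)
      where open ≡-Reasoning

-- Walks as vertex sequences

module Paths {n : ℕ} (G : Graph n) where
  open Walks G

  avoids : ∀ {p u v k} (w : NB p u v k) {l} → code w ≢ p ∷ l
  avoids (step _ x≢p _) eq = x≢p (∷-injectiveˡ eq)

  -- Only indices up to `K` are constrained, so shifting and reversing a path are mere changes of
  -- index.
  Path : ℕ → (ℕ → V) → Set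
  Path K F = (∀ t → t < K → F t ~ F (suc t)) × (∀ t → suc t < K → F t ≢ F (2 + t))

  reverse-path : ∀ {K F} → Path K F → Path K (λ t → F (K ∸ t))
  reverse-path {K} {F} (adj , turn) = adj′ , turn′
    where
    lower : ∀ {t} → t < K → K ∸ t ≡ suc (K ∸ suc t)
    lower t<K = +-∸-assoc 1 t<K
    adj′ : ∀ t → t < K → F (K ∸ t) ~ F (K ∸ suc t)
    adj′ t t<K = subst (λ s → F s ~ F (K ∸ suc t)) (sym (lower t<K))
      (~-sym (adj (K ∸ suc t) (subst (_≤ K) (lower t<K) (m∸n≤m K t))))
    turn′ : ∀ t → suc t < K → F (K ∸ t) ≢ F (K ∸ (2 + t))
    turn′ t t+1<K eq = turn (K ∸ (2 + t)) (subst (_≤ K) two (m∸n≤m K t))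
      (trans (sym eq) (cong F two))
      where
      two : K ∸ t ≡ 2 + (K ∸ (2 + t))
      two = trans (lower (<⇒≤ t+1<K)) (cong suc (lower t+1<K))

  drop-path : ∀ s {K F} → Path (s + K) F → Path K (λ t → F (s + t))
  drop-path s {K} {F} (adj , turn) =
    (λ t t<K → subst (λ r → F (s + t) ~ F r) (sym (+-suc s t))
                 (adj (s + t) (subst (_≤ s + K) (+-suc s t) (+-monoʳ-≤ s t<K)))) ,
    (λ t t<K eq → turn (s + t)
       (subst (_≤ s + K) (trans (+-suc s (suc t)) (cong suc (+-suc s t))) (+-monoʳ-≤ s t<K))
       (trans eq (cong F (trans (+-suc s (suc t)) (cong suc (+-suc s t))))))

  -- Runs back along the path to `F 0` and goes on along `w`, which avoids `F 1`, so that the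
  -- junction does not backtrack.
  down : ∀ {K F v l} → Path K F → ∀ k → suc k ≤ K → NB (F 1) (F 0) v l → NB (F (suc k)) (F k) v (k + l)
  down path zero    _   w = w
  down path@(adj , turn) (suc k) k<K w =
    step (~-sym (adj k (<⇒≤ k<K))) (turn k k<K) (down path k (<⇒≤ k<K) w)

  pos : ∀ {p u v k} → NB p u v k → ℕ → V
  pos {u = u} _            zero    = u
  -- A default value: past its end the walk rests at its last vertex, where `Path` asks nothing.
  pos {u = u} []           (suc _) = u
  pos         (step _ _ w) (suc i) = pos w i

  pos-end : ∀ {p u v k} (w : NB p u v k) → pos w k ≡ v
  pos-end []           = refl
  pos-end (step _ _ w) = pos-end w

  pos-path : ∀ {p u v k} (w : NB p u v k) → Path k (pos w)
  pos-path w = joins w , turns w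
    where
    joins : ∀ {p u v k} (w : NB p u v k) t → t < k → pos w t ~ pos w (suc t)
    joins (step ux _ w) zero    _         = ux
    joins (step _ _ w)  (suc t) (s≤s t<k) = joins w t t<k
    turns : ∀ {p u v k} (w : NB p u v k) t → suc t < k → pos w t ≢ pos w (2 + t)
    turns (step _ _ (step _ y≢u w)) zero    _         = ≢-sym y≢u
    turns (step _ _ w)              (suc t) (s≤s t<k) = turns w t t<k

  snoc : ∀ {p u v x k} (w : NB p u v (suc k)) → v ~ x → x ≢ pos w k → NB p u x (2 + k)
  snoc (step ux x≢p [])               vx ne = step ux x≢p (step vx ne [])
  snoc (step ux x≢p w@(step _ _ _))   vx ne = step ux x≢p (snoc w vx ne)

  pos-snoc : ∀ {p u v x k} (w : NB p u v (suc k)) (vx : v ~ x) (ne : x ≢ pos w k) →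
             ∀ t → t ≤ suc k → pos (snoc w vx ne) t ≡ pos w t
  pos-snoc w _ _ zero _ = refl
  pos-snoc (step _ _ []) _ _ (suc zero) _ = refl
  pos-snoc (step _ _ []) _ _ (suc (suc _)) (s≤s ())
  pos-snoc (step _ _ w@(step _ _ _)) vx ne (suc t) (s≤s t≤k) = pos-snoc w vx ne t t≤k

  init : ∀ {p u v k} (w : NB p u v (suc k)) → NB p u (pos w k) k
  init (step _ _ [])                = []
  init (step ux x≢p w@(step _ _ _)) = step ux x≢p (init w)

  code-init : ∀ {p u v k} (w : NB p u v (suc k)) → code w ≡ code (init w) ∷ʳ v
  code-init (step _ _ [])                  = refl
  code-init (step {x = x} _ _ w@(step _ _ _)) = cong (x ∷_) (code-init w)

  -- F and G bound a closed walk of length 2 (1 + M), of which F M and G 3 are opposite points.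
  opposite-walks : ∀ {M} μ → M ≡ 2 + μ → ∀ {F G} → Path (3 + M) F → Path (3 + M) G →
    F 1 ≡ G 1 → F (2 + M) ≡ G (2 + M) → F 2 ≢ G 2 → F (suc M) ≢ G (suc M) →
    TwoWalks (suc M) (F M) (F M) (G 3)
  opposite-walks μ refl {F} {G} pF@(adjF , turnF) pG@(adjG , turnG) start end F₂≢G₂ F₋₁≢G₋₁ =
    _ , _ , forget back , step first-edge (≢-sym (~⇒≢ first-edge)) on ,
    ≤-reflexive (cong suc (+-comm μ 2)) , ≤-reflexive (cong (3 +_) (+-identityʳ μ)) ,
    -- `back` avoids `F (suc M)`, which is the first vertex that the other walk visits.
    λ eq → avoids back (trans (sym (code-forget back)) eq)
    where
    first-edge : F (2 + μ) ~ F (3 + μ)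
    first-edge = adjF (2 + μ) (s≤s (s≤s (s≤s (m≤n+m μ 2))))
    turn-around : NB (F 2) (F 1) (G 3) 2
    turn-around = subst (λ x → NB (F 2) x (G 3) 2) (sym start)
      (step (adjG 1 (s≤s (s≤s z≤n))) (≢-sym F₂≢G₂)
        (step (adjG 2 (s≤s (s≤s (s≤s z≤n)))) (≢-sym (turnG 1 (s≤s (s≤s (s≤s z≤n))))) []))
    back : NB (F (3 + μ)) (F (2 + μ)) (G 3) (suc μ + 2)
    back = down (drop-path 1 pF) (suc μ) (s≤s (s≤s (m≤n+m μ 2))) turn-around
    descent : NB (G (4 + μ)) (G (3 + μ)) (G 3) (μ + 0)
    descent = down (drop-path 3 pG) μ (n≤1+n _) []
    on : NB (F (2 + μ)) (F (3 + μ)) (G 3) (2 + (μ + 0))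
    on = step (adjF (3 + μ) (n≤1+n _)) (≢-sym (turnF (2 + μ) (n≤1+n _)))
      (subst (λ x → NB (F (3 + μ)) x (G 3) (suc (μ + 0))) (sym end)
        (step (~-sym (adjG (3 + μ) (n≤1+n _))) (≢-sym F₋₁≢G₋₁) descent))

-- Cycles inside closed walks

module ClosedWalks {n : ℕ} (G : Graph n) where
  open Walks G
  open Paths G

  -- No condition is placed on the turn at the base point, so a segment between two equal vertices
  -- is again a closed path.
  ClosedPath : ℕ → (ℕ → V) → Set
  ClosedPath L F = 1 ≤ L × Path L F × F 0 ≡ F L

  injective⇒cycle : ∀ {L F} → ClosedPath L F →
    (∀ (i j : Fin L) → toℕ i < toℕ j → F (toℕ i) ≢ F (toℕ j)) → Cycle G L
  injective⇒cycle {1} (_ , (joins , _) , closed) _ = contradiction closed (~⇒≢ (joins 0 ≤-refl))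
  injective⇒cycle {2} (_ , (_ , turns) , closed) _ = contradiction closed (turns 0 ≤-refl)
  injective⇒cycle {suc M@(suc (suc _))} {F} (_ , (joins , _) , closed) distinct =
    s≤s (s≤s (s≤s z≤n)) , M , refl , F ∘ toℕ , injective ,
    (λ i → subst (λ t → F t ~ F (suc (toℕ i))) (sym (toℕ-inject₁ i)) (joins (toℕ i) (m≤n⇒m≤1+n (toℕ<n i)))) ,
    subst₂ (λ t x → F t ~ x) (sym (toℕ-fromℕ M)) (sym closed) (joins M ≤-refl)
    where
    injective : ∀ {i j} → F (toℕ i) ≡ F (toℕ j) → i ≡ j
    injective {i} {j} eq with <-cmp (toℕ i) (toℕ j)
    ... | tri< i<j _ _ = contradiction eq (distinct i j i<j)
    ... | tri≈ _ i≡j _ = toℕ-injective i≡j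
    ... | tri> _ _ j<i = contradiction (sym eq) (distinct j i j<i)

  -- Strong induction on the length: if two of the vertices coincide, the segment between them is a
  -- shorter closed path.
  closed-path⇒cycle : ∀ L F → ClosedPath L F → ∃[ k ] k ≤ L × Cycle G k
  closed-path⇒cycle = <-rec (λ L → ∀ F → ClosedPath L F → ∃[ k ] k ≤ L × Cycle G k) shorten
    where
    shorten : ∀ L → (∀ {K} → K < L → ∀ F → ClosedPath K F → ∃[ k ] k ≤ K × Cycle G k) →
              ∀ F → ClosedPath L F → ∃[ k ] k ≤ L × Cycle G k
    shorten L rec F path@(_ , (joins , turns) , _)
      with any? (λ (i : Fin L) → any? (λ (j : Fin L) → (toℕ i <? toℕ j) ×-dec (F (toℕ i) ≟ᶠ F (toℕ j))))
    ... | no none = L , ≤-refl , injective⇒cycle path (λ i j i<j eq → none (i , j , i<j , eq))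
    ... | yes (i , j , i<j , eq) with rec K<L (λ t → F (toℕ i + t)) (m<n⇒0<n∸m i<j , inner , ends)
      where
      K<L : toℕ j ∸ toℕ i < L
      K<L = ≤-trans (s≤s (m∸n≤m (toℕ j) (toℕ i))) (toℕ<n j)
      i+K≡j : toℕ i + (toℕ j ∸ toℕ i) ≡ toℕ j
      i+K≡j = m+[n∸m]≡n (<⇒≤ i<j)
      within : ∀ {t} → t < toℕ i + (toℕ j ∸ toℕ i) → t < L
      within t< = ≤-trans (subst (_ ≤_) i+K≡j t<) (<⇒≤ (toℕ<n j))
      inner : Path (toℕ j ∸ toℕ i) (λ t → F (toℕ i + t))
      inner = drop-path (toℕ i) ((λ t t< → joins t (within t<)) , (λ t t< → turns t (within t<)))
      ends : F (toℕ i + 0) ≡ F (toℕ i + (toℕ j ∸ toℕ i))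
      ends = trans (cong F (+-identityʳ (toℕ i))) (trans eq (cong F (sym i+K≡j)))
    ...   | k , k≤K , cycle = k , ≤-trans k≤K (≤-trans (m∸n≤m (toℕ j) (toℕ i)) (<⇒≤ (toℕ<n j))) , cycle

  -- After deleting common first steps, run `w` backwards and then `w′` forwards. The turn at the
  -- start is legitimate since the first steps differ; the closing point needs no check.
  two-walks⇒closed-path : ∀ {p p′ u v a b} (w : NB p u v a) (w′ : NB p′ u v b) → code w ≢ code w′ →
                          ∃₂ λ L F → L ≤ a + b × ClosedPath L F
  two-walks⇒closed-path [] [] ne = contradiction refl ne
  two-walks⇒closed-path [] w′@(step _ _ _) _ =
    _ , pos w′ , ≤-refl , s≤s z≤n , pos-path w′ , sym (pos-end w′)
  two-walks⇒closed-path w@(step _ _ _) [] _ =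
    _ , pos w , m≤m+n _ 0 , s≤s z≤n , pos-path w , sym (pos-end w)
  two-walks⇒closed-path {a = suc a} {suc b} w@(step {x = x} _ _ v₁) (step {x = y} uy _ v₂) ne with y ≟ᶠ x
  ... | yes refl with two-walks⇒closed-path v₁ v₂ (ne ∘ cong (x ∷_))
  ...   | L , F , L≤ , path = L , F , ≤-trans L≤ (+-mono-≤ (n≤1+n a) (n≤1+n b)) , path
  two-walks⇒closed-path {a = suc a} {suc b} w@(step {x = x} _ _ v₁) (step {x = y} uy _ v₂) ne | no y≢x =
    _ , pos around , ≤-refl , s≤s z≤n , pos-path around , trans (pos-end w) (sym (pos-end around))
    where
    last-edge : pos w a ~ pos w (suc a)
    last-edge = proj₁ (pos-path w) a ≤-refl
    around : NB (pos w (suc a)) (pos w (suc a)) _ (suc a + suc b)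
    around = step (~-sym last-edge) (~⇒≢ last-edge) (down (pos-path w) a ≤-refl (step uy y≢x v₂))

-- Cycles traversed periodically

module Circuits {n : ℕ} (G : Graph n) where
  open Walks G

  -- Indexing by all natural numbers lets offsets be added freely; `reach` does the work of
  -- reduction modulo L.
  record Circuit (L : ℕ) : Set where
    field
      at       : ℕ → V
      adjacent : ∀ i → at i ~ at (suc i)
      periodic : ∀ i → at (L + i) ≡ at i
      distinct : ∀ i t → 1 ≤ t → t < L → at (t + i) ≢ at i
      reach    : ∀ i j → ∃[ t ] t < L × (∀ s → at (s + j) ≡ at (s + (t + i)))

  module _ {M : ℕ} (c : Fin (suc M) → V)
    (inj : ∀ {i j} → c i ≡ c j → i ≡ j)
    (adjacent : ∀ i → c (inject₁ i) ~ c (suc i)) (closing : c (fromℕ M) ~ c zero) where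

    private
      L : ℕ
      L = suc M

      toℕ-mod : ∀ i → toℕ (i mod L) ≡ i % L
      toℕ-mod i = toℕ-fromℕ< (m%n<n i L)

      at : ℕ → V
      at i = c (i mod L)

      at-cong : ∀ i j → i % L ≡ j % L → at i ≡ at j
      at-cong i j eq = cong c (toℕ-injective (trans (toℕ-mod i) (trans eq (sym (toℕ-mod j)))))

      %-suc : ∀ i → suc i % L ≡ suc (i % L) % L
      %-suc i = trans (cong (λ j → suc j % L) (m≡m%n+[m/n]*n i L)) ([m+kn]%n≡m%n (suc (i % L)) (i / L) L)

      adjacent-toℕ : ∀ a b → toℕ b ≡ suc (toℕ a) → c a ~ c b
      adjacent-toℕ a (suc b) eq =
        subst (λ x → c x ~ c (suc b))
          (toℕ-injective (trans (toℕ-inject₁ b) (suc-injective eq))) (adjacent b)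

      at-adjacent : ∀ i → at i ~ at (suc i)
      at-adjacent i with m≤n⇒m<n∨m≡n (m%n<n i L)
      ... | inj₁ 1+r<L = adjacent-toℕ (i mod L) (suc i mod L)
        (trans (toℕ-mod (suc i)) (trans (%-suc i)
          (trans (m<n⇒m%n≡m 1+r<L) (cong suc (sym (toℕ-mod i))))))
      ... | inj₂ 1+r≡L = subst₂ _~_
        (cong c (toℕ-injective (trans (toℕ-fromℕ M) (sym (trans (toℕ-mod i) (suc-injective 1+r≡L))))))
        (cong c (toℕ-injective (sym (trans (toℕ-mod (suc i))
          (trans (%-suc i) (trans (cong (_% L) 1+r≡L) (n%n≡0 L)))))))
        closing

      at-distinct : ∀ i t → 1 ≤ t → t < L → at (t + i) ≢ at i
      at-distinct i t 1≤t t<L eq =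
        >⇒∤ {{>-nonZero 1≤t}} t<L (∣m+n∣m⇒∣n {m = i / L * L} (divides ((t + i) / L) multiple) (divides-refl (i / L)))
        where
        open ≡-Reasoning
        same : (t + i) % L ≡ i % L
        same = trans (sym (toℕ-mod (t + i))) (trans (cong toℕ (inj eq)) (toℕ-mod i))
        shift : ∀ a b c → a + (b + c) ≡ b + (c + a)
        shift = solve-∀
        multiple : i / L * L + t ≡ (t + i) / L * L
        multiple = +-cancelˡ-≡ (i % L) _ _ (begin
          i % L + (i / L * L + t)                ≡⟨ shift t (i % L) (i / L * L) ⟨
          t + (i % L + i / L * L)                ≡⟨ cong (t +_) (m≡m%n+[m/n]*n i L) ⟨
          t + i                                  ≡⟨ m≡m%n+[m/n]*n (t + i) L ⟩
          (t + i) % L + (t + i) / L * L          ≡⟨ cong (_+ (t + i) / L * L) same ⟩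
          i % L + (t + i) / L * L                ∎)

      at-reach : ∀ i j → ∃[ t ] t < L × (∀ s → at (s + j) ≡ at (s + (t + i)))
      at-reach i j = t , m%n<n (j + i * M) L , λ s → at-cong (s + j) (s + (t + i)) (same s)
        where
        open ≡-Reasoning
        -- M is -1 modulo L, so j + i * M stands for j - i without truncated subtraction.
        t : ℕ
        t = (j + i * M) % L
        k : ℕ
        k = (j + i * M) / L
        regroup : ∀ s j i M → s + j + i * suc M ≡ s + ((j + i * M) + i)
        regroup = solve-∀
        regroup′ : ∀ s t i k → s + ((t + k) + i) ≡ s + (t + i) + k
        regroup′ = solve-∀
        same : ∀ s → (s + j) % L ≡ (s + (t + i)) % L
        same s = begin
          (s + j) % L                      ≡⟨ [m+kn]%n≡m%n (s + j) i L ⟨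
          (s + j + i * L) % L              ≡⟨ cong (_% L) (regroup s j i M) ⟩
          (s + ((j + i * M) + i)) % L      ≡⟨ cong (λ x → (s + (x + i)) % L) (m≡m%n+[m/n]*n (j + i * M) L) ⟩
          (s + ((t + k * L) + i)) % L      ≡⟨ cong (_% L) (regroup′ s t i (k * L)) ⟩
          (s + (t + i) + k * L) % L        ≡⟨ [m+kn]%n≡m%n (s + (t + i)) k L ⟩
          (s + (t + i)) % L                ∎

    circuit : Circuit (suc M)
    circuit = record
      { at       = at
      ; adjacent = at-adjacent
      ; periodic = λ i → at-cong (L + i) i (trans (cong (_% L) (+-comm L i)) ([m+n]%n≡m%n i L))
      ; distinct = at-distinct
      ; reach    = at-reach
      }

  cycle⇒circuit : ∀ {k} → Cycle G k → 3 ≤ k × Circuit k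
  cycle⇒circuit (3≤k , M , refl , c , inj , adj , closing) = 3≤k , circuit c inj adj closing

  module Arcs {L : ℕ} (3≤L : 3 ≤ L) (C : Circuit L) where
    open Circuit C renaming (at to c)

    turn : ∀ i → c (2 + i) ≢ c i
    turn i = distinct i 2 (s≤s z≤n) 3≤L

    forward : ∀ r {i p v} → c (suc i) ≢ p → v ≡ c (r + i) → NB p (c i) v r
    forward zero    _  refl = []
    forward (suc r) {i} ne eq =
      step (adjacent i) ne (forward r (turn i) (trans eq (cong c (sym (+-suc r i)))))

    backward : ∀ r {i p u} → (∀ s → r ≡ suc s → c (s + i) ≢ p) → u ≡ c (r + i) → NB p u (c i) r
    backward zero    _  refl = []
    backward (suc r) {i} ne refl =
      step (~-sym (adjacent (r + i))) (ne r refl)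
        (backward r (λ { s refl → ≢-sym (turn (s + i)) }) refl)

-- Graphs of defect two

module DefectTwo {n : ℕ} (G : Graph n) (q m : ℕ) (3≤q : 3 ≤ q) (3≤m : 3 ≤ m)
  (max-degree : MaxDegree G (suc q)) (diameter : Diameter G (suc m))
  (order : n + 2 ≡ Moore (suc q) (suc m)) where

  open Walks G
  open Counting G
  open Paths G
  open Circuits G

  1≤P : ∀ u v → 1 ≤ P (suc m) u v
  1≤P u v with proj₁ diameter u v
  ... | _ , k≤D , w , _ with nonbacktracking w
  ...   | _ , a≤k , w′ = 1≤T w′ (≤-trans a≤k k≤D)

  g : ℕ
  g = geomSum q (suc m)

  3≤g : 3 ≤ g
  3≤g = begin
    3                      ≤⟨ 3≤q ⟩
    q                      ≡⟨ *-identityʳ q ⟨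
    q * 1                  ≤⟨ *-monoʳ-≤ q (positive m (≤-trans (s≤s z≤n) 3≤m)) ⟩
    q * geomSum q m        ≤⟨ n≤1+n _ ⟩
    1 + q * geomSum q m    ≡⟨ geomSum-step q m ⟩
    g                      ∎
    where
    open ≤-Reasoning
    positive : ∀ i → 1 ≤ i → 1 ≤ geomSum q i
    positive (suc i) _ = subst (1 ≤_) (geomSum-step q i) (s≤s z≤n)

  -- A vertex of degree at most q starts at most 1 + q g of these walks, yet reaches all (q + 1) g -
  -- 1 vertices, which would force g ≤ 2.
  regular : ∀ u → degree G u ≡ suc q
  regular u with m≤n⇒m<n∨m≡n (proj₁ max-degree u)
  ... | inj₂ eq = eq
  ... | inj₁ (s≤s deg≤q) = contradiction (≤-trans 3≤g g≤2) λ { (s≤s (s≤s ())) }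
    where
    open ≤-Reasoning
    open Totals _≤_ ≤-refl ≤-trans +-mono-≤ *-mono-≤ s≤s⁻¹
    shift : ∀ a b → 1 + (a + b) ≡ a + (1 + b)
    shift = solve-∀
    g≤2 : g ≤ 2
    g≤2 = +-cancelʳ-≤ (1 + q * g) g 2 (begin
      g + (1 + q * g)                     ≡⟨ shift g (q * g) ⟨
      1 + suc q * g                       ≡⟨ order ⟨
      n + 2                               ≡⟨ cong (_+ 2) (sum-ones n) ⟨
      sum {n} (λ _ → 1) + 2               ≤⟨ +-monoˡ-≤ 2 (sum-mono-≤ (1≤P u)) ⟩
      sum (P (suc m) u) + 2               ≤⟨ +-monoˡ-≤ 2 (root-total-∼ (proj₁ max-degree) m u) ⟩
      1 + degree G u * g + 2              ≤⟨ +-monoˡ-≤ 2 (s≤s (*-monoˡ-≤ g deg≤q)) ⟩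
      1 + q * g + 2                       ≡⟨ +-comm (1 + q * g) 2 ⟩
      2 + (1 + q * g)                     ∎)

  open Regular q regular

  ΣP : ∀ u → sum (P (suc m) u) ≡ n + 2
  ΣP u = trans (root-total-∼ regular m u)
               (trans (cong (λ k → 1 + k * g) (regular u)) (sym order))
    where open Totals _≡_ refl trans (cong₂ _+_) (cong₂ _*_) suc-injective

  -- Repeats, and cycles of length at most 2D - 2

  Rep : V → V → Set
  Rep u v = 2 ≤ P (suc m) u v

  Rep-sym : ∀ {u v} → Rep u v → Rep v u
  Rep-sym {u} {v} = subst (2 ≤_) (P-sym (suc m) u v)

  -- Every vertex is reached at least once and the total is n + 2, which leaves room for two surplus
  -- walks only.
  no-three-repeats : ∀ {u x y z} → Rep u x → Rep u y → Rep u z → x ≢ y → x ≢ z → y ≢ z → ⊥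
  no-three-repeats {u} {x} {y} {z} rx ry rz x≢y x≢z y≢z = <-irrefl refl (begin
    3 + n                                             ≡⟨ cong₂ _+_ (sum-three-δ x y z) (sum-ones n) ⟨
    sum (λ v → δ x v + δ y v + δ z v) + sum {n} (λ _ → 1)
      ≡⟨ ∑-distrib-+ (λ v → δ x v + δ y v + δ z v) (λ _ → 1) ⟨
    sum (λ v → δ x v + δ y v + δ z v + 1)             ≤⟨ sum-mono-≤ pointwise ⟩
    sum (P (suc m) u)                                 ≡⟨ ΣP u ⟩
    n + 2                                             ≡⟨ +-comm n 2 ⟩
    2 + n                                             ∎)
    where
    open ≤-Reasoning
    bound : ∀ v → δ x v + δ y v + δ z v ≤ 1
    bound = three-δ≤1 x≢y x≢z y≢z
    pointwise : ∀ v → δ x v + δ y v + δ z v + 1 ≤ P (suc m) u v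
    pointwise v with x ≟ᶠ v | y ≟ᶠ v | z ≟ᶠ v | bound v
    ... | yes refl | _        | _        | b = ≤-trans (+-monoˡ-≤ 1 b) rx
    ... | no _     | yes refl | _        | b = ≤-trans (+-monoˡ-≤ 1 b) ry
    ... | no _     | no _     | yes refl | b = ≤-trans (+-monoˡ-≤ 1 b) rz
    ... | no _     | no _     | no _     | _ = 1≤P u v

  repeats-exhausted : ∀ {u x y z} → Rep u x → Rep u y → x ≢ y → Rep u z → z ≡ x ⊎ z ≡ y
  repeats-exhausted {x = x} {y} {z} rx ry x≢y rz with z ≟ᶠ x | z ≟ᶠ y
  ... | yes z≡x | _       = inj₁ z≡x
  ... | no _    | yes z≡y = inj₂ z≡y
  ... | no z≢x  | no z≢y  = ⊥-elim (no-three-repeats rx ry rz x≢y (≢-sym z≢x) (≢-sym z≢y))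

  -- Otherwise the total would be at most n instead of n + 2. The two walks found here later produce
  -- the cycle of length 2D.
  repeat-exists : V → ∃₂ λ u v → Rep u v
  repeat-exists u with any? (λ v → 2 ≤? P (suc m) u v)
  ... | yes (v , r) = u , v , r
  ... | no none = contradiction (begin
      n + 2                 ≡⟨ ΣP u ⟨
      sum (P (suc m) u)     ≤⟨ sum-mono-≤ (λ v → s≤s⁻¹ (≰⇒> (λ r → none (v , r)))) ⟩
      sum {n} (λ _ → 1)     ≡⟨ sum-ones n ⟩
      n                     ∎) (m+1+n≰m n)
    where open ≤-Reasoning

  -- One entry of the matrix identity A P = P A.
  repeat-of-neighbour : ∀ {u w r} → u ~ w → Rep w r → ∃[ x ] x ~ r × Rep u x
  repeat-of-neighbour {u} {w} {r} uw wr
    with any? (λ x → (adj G x r Bool.≟ true) ×-dec (2 ≤? P (suc m) u x))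
  ... | yes found = found
  -- Each neighbour of `u` contributes at least 1 to the entry of A P, and `w` at least 2; with no
  -- repeat of `u` adjacent to `r`, each neighbour of `r` contributes at most 1 to that of P A.
  ... | no none = contradiction (begin
      suc (suc q)                         ≡⟨ cong suc (ΣA u) ⟨
      1 + sum (A u)                       ≡⟨ cong (_+ sum (A u)) (sum-δ w) ⟨
      sum (δ w) + sum (A u)               ≡⟨ ∑-distrib-+ (δ w) (A u) ⟨
      sum (λ x → δ w x + A u x)           ≤⟨ sum-mono-≤ lower ⟩
      AP (suc m) u r                      ≡⟨ commute (suc m) u r ⟩
      PA (suc m) u r                      ≤⟨ sum-mono-≤ upper ⟩
      sum (λ x → A x r)                   ≡⟨ ΣAᵀ r ⟩
      suc q                               ∎) 1+n≰n
    where
    open ≤-Reasoning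
    lower : ∀ x → δ w x + A u x ≤ A u x * P (suc m) x r
    lower x with w ≟ᶠ x
    ... | yes refl = subst (λ a → 1 + a ≤ a * P (suc m) w r) (sym (A-~ uw)) (≤-trans wr (m≤m+n _ 0))
    ... | no _ = ≤-trans (≤-reflexive (sym (*-identityʳ (A u x)))) (*-monoʳ-≤ (A u x) (1≤P x r))
    upper : ∀ x → P (suc m) u x * A x r ≤ A x r
    upper x with adj G x r in eq
    ... | false = ≤-reflexive (*-zeroʳ (P (suc m) u x))
    ... | true  = ≤-trans (≤-reflexive (*-identityʳ (P (suc m) u x)))
                          (s≤s⁻¹ (≰⇒> (λ rep → none (x , eq , rep))))

  neighbour-avoiding : ∀ u s t r → ∃[ x ] u ~ x × x ≢ s × x ≢ t × x ≢ r
  neighbour-avoiding u s t r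
    with any? (λ x → (adj G u x Bool.≟ true) ×-dec ¬? (x ≟ᶠ s) ×-dec ¬? (x ≟ᶠ t) ×-dec ¬? (x ≟ᶠ r))
  ... | yes found = found
  ... | no none = contradiction (begin
      4                                        ≤⟨ s≤s 3≤q ⟩
      suc q                                    ≡⟨ ΣA u ⟨
      sum (A u)                                ≤⟨ sum-mono-≤ covered ⟩
      sum (λ x → δ s x + δ t x + δ r x)        ≡⟨ sum-three-δ s t r ⟩
      3                                        ∎) 1+n≰n
    where
    open ≤-Reasoning
    covered : ∀ x → A u x ≤ δ s x + δ t x + δ r x
    covered x with adj G u x in eq | s ≟ᶠ x | t ≟ᶠ x | r ≟ᶠ x
    ... | false | _     | _     | _     = z≤n
    ... | true  | yes _ | _     | _     = s≤s z≤n
    ... | true  | no _  | yes _ | _     = s≤s z≤n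
    ... | true  | no _  | no _  | yes _ = s≤s z≤n
    ... | true  | no a  | no b  | no c  =
      contradiction (x , eq , ≢-sym a , ≢-sym b , ≢-sym c) none

  repeat : ∀ {p p′ u v a b} (w : NB p u v a) (w′ : NB p′ u v b) → code w ≢ code w′ →
           a ≤ suc m → b ≤ suc m → Rep u v
  repeat w w′ ne = 2≤T (forget w) (forget w′)
    (λ eq → ne (trans (sym (code-forget w)) (trans eq (code-forget w′))))

  first : ∀ {p u v k} → NB p u v k → V
  first {u = u} []        = u
  first (step {x = x} _ _ _) = x

  avoiding : ∀ {p u v k x} (w : NB p u v k) → x ≢ first w → NB x u v k
  avoiding []             _ = []
  avoiding (step uy _ w) ne = step uy (≢-sym ne) w

  code-avoiding : ∀ {p u v k x} (w : NB p u v k) (ne : x ≢ first w) → code (avoiding w ne) ≡ code w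
  code-avoiding []           _ = refl
  code-avoiding (step _ _ _) _ = refl

  -- Otherwise u and two of its neighbours off both walks would be three repeats of v.
  short-walks-unique : ∀ {p p′ u v a b} (w : NB p u v a) (w′ : NB p′ u v b) →
                       a ≤ m → b ≤ m → code w ≡ code w′
  short-walks-unique {u = u} {v} w w′ a≤m b≤m with ≡-dec _≟ᶠ_ (code w) (code w′)
  ... | yes eq = eq
  ... | no ne with neighbour-avoiding u (first w) (first w′) (first w′)
  ...   | x , ux , x≢f , x≢f′ , _ with neighbour-avoiding u (first w) (first w′) x
  ...     | y , uy , y≢f , y≢f′ , y≢x =
    ⊥-elim (no-three-repeats (Rep-sym (repeat w w′ ne (m≤n⇒m≤1+n a≤m) (m≤n⇒m≤1+n b≤m)))
      (Rep-sym (extend ux x≢f x≢f′)) (Rep-sym (extend uy y≢f y≢f′))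
      (~⇒≢ ux) (~⇒≢ uy) (≢-sym y≢x))
    where
    extend : ∀ {z} → u ~ z → z ≢ first w → z ≢ first w′ → Rep z v
    extend {z} uz z≢f z≢f′ = repeat
      (step (~-sym uz) (~⇒≢ uz) (avoiding w z≢f)) (step (~-sym uz) (~⇒≢ uz) (avoiding w′ z≢f′))
      (λ eq → ne (trans (sym (code-avoiding w z≢f))
                        (trans (∷-injectiveʳ eq) (code-avoiding w′ z≢f′))))
      (s≤s a≤m) (s≤s b≤m)

  -- Two nearly antipodal vertices cut the circuit into arcs of length at most m that start in
  -- different directions, against the uniqueness of short walks.
  no-cycle-≤2m : ∀ {k} → k ≤ m + m → ¬ Cycle G k
  no-cycle-≤2m {k} k≤2m cyc with cycle⇒circuit cyc
  no-cycle-≤2m {suc zero} _ _ | s≤s () , _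
  no-cycle-≤2m {suc (suc l)} k≤2m cyc | 3≤k , C =
    avoids other (sym (short-walks-unique one other (≤-trans (⌊n/2⌋≤⌈n/2⌉ (2 + l)) r≤m) r≤m))
    where
    open Circuit C renaming (at to c)
    open Arcs 3≤k C
    j r : ℕ
    j = ⌊ 2 + l /2⌋
    r = ⌈ 2 + l /2⌉
    r≤m : r ≤ m
    r≤m = subst (r ≤_) (sym (n≡⌈n+n/2⌉ m)) (⌈n/2⌉-mono k≤2m)
    r+j≡k : r + j ≡ 2 + l
    r+j≡k = trans (+-comm r j) (⌊n/2⌋+⌈n/2⌉≡n (2 + l))
    one : NB (c 0) (c 0) (c j) j
    one = step (adjacent 0) (≢-sym (~⇒≢ (adjacent 0)))
      (forward ⌊ l /2⌋ (turn 0) (cong c (+-comm 1 ⌊ l /2⌋)))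
    other : NB (c 1) (c 0) (c j) r
    other = backward r away (trans (sym (periodic 0)) (cong c (trans (+-identityʳ (2 + l)) (sym r+j≡k))))
      where
      away : ∀ s → r ≡ suc s → c (s + j) ≢ c 1
      away s r≡1+s eq = distinct 1 l (s≤s⁻¹ (s≤s⁻¹ 3≤k)) (n≤1+n _)
        (trans (cong c (trans (+-comm l 1) (sym (suc-injective (trans (cong (_+ j) (sym r≡1+s)) r+j≡k))))) eq)

  -- Excluding a cycle of length 2D - 1

  module OddCycle (C : Circuit (suc (m + m))) where
    open Circuit C renaming (at to c)

    3≤L : 3 ≤ suc (m + m)
    3≤L = ≤-trans 3≤m (≤-trans (m≤m+n m m) (n≤1+n _))

    open Arcs 3≤L C

    full-turn : ∀ i → c i ≡ c (suc m + (m + i))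
    full-turn i = trans (sym (periodic i)) (cong c (cong suc (+-assoc m m i)))

    full-turn′ : ∀ i → c i ≡ c (m + (suc m + i))
    full-turn′ i = trans (full-turn i) (cong c (sym (+-suc m (m + i))))

    forward-free : ∀ r {i v} → v ≡ c (r + i) → NB (c i) (c i) v r
    forward-free r {i} = forward r (≢-sym (~⇒≢ (adjacent i)))

    backward-free : ∀ r {i u} → u ≡ c (r + i) → NB u u (c i) r
    backward-free r {i} refl = backward r (λ { s refl → ~⇒≢ (adjacent (s + i)) }) refl

    -- The two arcs joining these vertices have lengths m and m + 1, both at most D.
    repeat-m : ∀ i → Rep (c i) (c (m + i))
    repeat-m i = repeat w w′ (length-differ w w′ (<⇒≢ ≤-refl)) (n≤1+n m) ≤-refl
      where
      w  = forward-free m {i} refl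
      w′ = backward-free (suc m) {m + i} (full-turn i)

    repeat-m+1 : ∀ i → Rep (c i) (c (suc m + i))
    repeat-m+1 i = repeat w w′ (length-differ w w′ (≢-sym (<⇒≢ ≤-refl))) ≤-refl (n≤1+n m)
      where
      w  = forward-free (suc m) {i} refl
      w′ = backward-free m {suc m + i} (full-turn′ i)

    OffC : V → Set
    OffC x = ∀ j → c j ≢ x

    repeat-on : ∀ {i x} → Rep (c i) x → ¬ OffC x
    repeat-on {i} r off
      with repeats-exhausted (repeat-m i) (repeat-m+1 i) (~⇒≢ (adjacent (m + i))) r
    ... | inj₁ eq = off _ (sym eq)
    ... | inj₂ eq = off _ (sym eq)

    repeat-off : ∀ {x y} → OffC x → Rep x y → OffC y
    repeat-off off r j refl = repeat-on (Rep-sym r) off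

    -- Two different walks would make `x` a repeat of a vertex of C, but both repeats of that vertex
    -- lie on C.
    off-unique : ∀ {p p′ x a b j} → OffC x → (w : NB p x (c j) a) (w′ : NB p′ x (c j) b) →
                 a ≤ suc m → b ≤ suc m → code w ≡ code w′
    off-unique off w w′ a≤ b≤ with ≡-dec _≟ᶠ_ (code w) (code w′)
    ... | yes eq = eq
    ... | no ne = ⊥-elim (repeat-on (Rep-sym (repeat w w′ ne a≤ b≤)) off)

    -- Takes the shorter of the two arcs; its first step stays on C and so cannot hit `p`.
    arc : ∀ {p} → OffC p → ∀ i j → ∃[ r ] r ≤ m × NB p (c i) (c j) r
    arc off i j with reach i j
    ... | t , t<L , same with t ≤? m
    ...   | yes t≤m = t , t≤m , forward t (off _) (same 0)
    ...   | no t≰m = r , r≤m , backward r (λ s _ → off _)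
      (sym (trans (same r) (trans (cong c (trans (sym (+-assoc r t i)) (cong (_+ i) (m∸n+n≡m (<⇒≤ t<L)))))
                                  (periodic i))))
      where
      r : ℕ
      r = suc (m + m) ∸ t
      r≤m : r ≤ m
      r≤m = ≤-trans (∸-monoʳ-≤ (suc (m + m)) (≰⇒> t≰m)) (≤-reflexive (m+n∸m≡n m m))

    -- A walk of length k from x to c i that meets the cycle only at c i; x′ is its second vertex, or x if k = 0.
    data Branch (i : ℕ) : V → V → ℕ → Set where
      root : ∀ {x} → x ≡ c i → Branch i x x 0
      up   : ∀ {x x′ x″ k} → OffC x → x ~ x′ → x ≢ x″ → Branch i x′ x″ k → Branch i x x′ (suc k)

    branch-off : ∀ {i x x′ k} → 1 ≤ k → Branch i x x′ k → OffC x
    branch-off _ (up off _ _ _) = off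

    -- A continuation from `c i` for a branch, quantified over `p` so that it can follow whichever
    -- vertex off C the branch comes down from.
    Link : ℕ → V → ℕ → Set
    Link i v r = ∀ {p} → OffC p → NB p (c i) v r

    link-forward : ∀ r {i v} → v ≡ c (r + i) → Link i v r
    link-forward r eq off = forward r (off _) eq

    link-backward : ∀ r {i j} → c i ≡ c (r + j) → Link i (c j) r
    link-backward r eq off = backward r (λ s _ → off _) eq

    here : ∀ {i} → Link i (c i) 0
    here = link-forward 0 refl

    descend : ∀ {i x x′ k p v r} → Link i v r → Branch i x x′ k → OffC p → x′ ≢ p → NB p x v (k + r)
    descend link (root refl)        off _  = link off
    descend link (up offx xx′ ne b) _   ne′ = step xx′ ne′ (descend link b offx (≢-sym ne))

    next≢ : ∀ {i x y k} → OffC x → Branch i x y k → y ≢ x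
    next≢ off (root refl)   _  = off _ refl
    next≢ off (up _ xy _ _) eq = ~⇒≢ xy (sym eq)

    to-cycle : ∀ {i x x′ k v r} → OffC x → Link i v r → Branch i x x′ k → NB x x v (k + r)
    to-cycle off link b = descend link b off (next≢ off b)

    -- Both branches prolong to walks from `x` to the same `c t`, which coincide by `off-unique`.
    -- Many contradictions below come from two such lengths that differ.
    same-length : ∀ {i j x y z k l t r s} → OffC x →
      Branch i x y k → Link i (c t) r → Branch j x z l → Link j (c t) s →
      k + r ≤ suc m → l + s ≤ suc m → k + r ≡ l + s
    same-length {k = k} {l} {r = r} {s} off b λb b′ λb′ ≤₁ ≤₂ =
      trans (sym (length-code w)) (trans (cong length (off-unique off w w′ ≤₁ ≤₂)) (length-code w′))
      where
      w  = to-cycle off λb b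
      w′ = to-cycle off λb′ b′

    same-first : ∀ {i j x y z k l t r s} →
      Branch i x y (suc k) → Link i (c t) r → Branch j x z (suc l) → Link j (c t) s →
      suc k + r ≤ suc m → suc l + s ≤ suc m → y ≡ z
    same-first (up off xy x≢y′ b) λb (up _ xz x≢z′ b′) λb′ ≤₁ ≤₂ = ∷-injectiveˡ (off-unique off
      (step xy (≢-sym (~⇒≢ xy)) (descend λb b off (≢-sym x≢y′)))
      (step xz (≢-sym (~⇒≢ xz)) (descend λb′ b′ off (≢-sym x≢z′))) ≤₁ ≤₂)

    -- Branches meet C only at their roots, so equal walks arrive on C at the same moment and at the
    -- same vertex.
    same-code⇒same-root : ∀ {i j x y z k l p p′ v v′ r s} (b : Branch i x y k) (λb : Link i v r)
      (b′ : Branch j x z l) (λb′ : Link j v′ s) (o : OffC p) (ne : y ≢ p) (o′ : OffC p′) (ne′ : z ≢ p′) →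
      code (descend λb b o ne) ≡ code (descend λb′ b′ o′ ne′) → c i ≡ c j
    same-code⇒same-root (root refl)  _ (root eq)         _ _ _ _ _ _ = eq
    same-code⇒same-root (root refl)  _ (up off _ _ _)    _ _ _ _ _ _ = ⊥-elim (off _ refl)
    same-code⇒same-root (up off _ _ _) _ (root refl)     _ _ _ _ _ _ = ⊥-elim (off _ refl)
    same-code⇒same-root (up off _ x≢ b) λb (up off′ _ x≢′ b′) λb′ _ _ _ _ eq with refl ← ∷-injectiveˡ eq =
      same-code⇒same-root b λb b′ λb′ off (≢-sym x≢) off′ (≢-sym x≢′) (∷-injectiveʳ eq)

    same-root : ∀ {i j x y z k l t r s} → Branch i x y k → Link i (c t) r → Branch j x z l → Link j (c t) s →
      OffC x → k + r ≤ suc m → l + s ≤ suc m → c i ≡ c j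
    same-root b λb b′ λb′ off ≤₁ ≤₂ =
      same-code⇒same-root b λb b′ λb′ off (next≢ off b) off (next≢ off b′)
        (off-unique off (to-cycle off λb b) (to-cycle off λb′ b′) ≤₁ ≤₂)

    -- If `p` were on C, the edge to it and an arc of length at most m would form a second walk of
    -- length at most D from `x` to `c i`.
    leave : ∀ {i x x′ p k} → Branch i x x′ (suc k) → suc k ≤ suc m → x ~ p → p ≢ x′ → OffC p
    leave {i} (up off xx′ x≢x″ b) k≤m xp p≢x′ j refl with arc off j i
    ... | r , r≤m , w = p≢x′ (∷-injectiveˡ (off-unique off
      (step xp (≢-sym (~⇒≢ xp)) w)
      (step xx′ (≢-sym (~⇒≢ xx′)) (descend here b off (≢-sym x≢x″)))
      (s≤s r≤m) (subst (_≤ suc m) (cong suc (sym (+-identityʳ _))) k≤m)))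

    -- By `leave` at each vertex, a nonbacktracking path that has left C does not meet it again
    -- while its height is at most D.
    climb : ∀ {K F i} → Path K F → F 0 ≡ c i → OffC (F 1) →
            ∀ k → 1 ≤ k → k ≤ suc m → k ≤ K → Branch i (F k) (F (pred k)) k
    climb (adjF , _) start off (suc zero) _ _ 1≤K =
      up off (~-sym (adjF 0 1≤K)) (≢-sym (~⇒≢ (adjF 0 1≤K))) (root start)
    climb path@(adjF , turnF) start off (suc (suc k)) _ k≤m k≤K =
      let b = climb path start off (suc k) (s≤s z≤n) (<⇒≤ k≤m) (<⇒≤ k≤K) in
      up (leave b (<⇒≤ k≤m) (adjF (suc k) k≤K) (≢-sym (turnF k k≤K)))
         (~-sym (adjF (suc k) k≤K)) (≢-sym (turnF k k≤K)) b

    record Repeats (i : ℕ) (x : V) (k : ℕ) : Set where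
      field
        {f f′ h h′} : V
        rep-f       : Rep x f
        rep-h       : Rep x h
        f≢h         : f ≢ h
        branch-f    : Branch (m + i) f f′ k
        branch-h    : Branch (suc m + i) h h′ k

    ClosedUnderRepeats : ℕ → Set
    ClosedUnderRepeats k = k ≤ m → ∀ {i x x′} → Branch i x x′ k → Repeats i x k

    -- The branches prolong to walks to `c i` of lengths k + 2 and at most k + 1.
    two-levels-apart : ∀ {i a r x y z k} → 2 + k ≤ m → r ≤ 1 → Link a (c i) r →
                       Branch i x y (2 + k) → Branch a x z k → ⊥
    two-levels-apart {r = r} {k = k} k≤m r≤1 link b b′ = 1+n≰n {suc k} (begin
      2 + k      ≡⟨ +-identityʳ (2 + k) ⟨
      2 + k + 0  ≡⟨ same-length (branch-off (s≤s z≤n) b) b here b′ link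
                      (subst (_≤ suc m) (sym (+-identityʳ (2 + k))) (m≤n⇒m≤1+n k≤m))
                      (≤-trans k+r≤1+k (≤-trans (n≤1+n _) (m≤n⇒m≤1+n k≤m))) ⟩
      k + r      ≤⟨ k+r≤1+k ⟩
      suc k      ∎)
      where
      open ≤-Reasoning
      k+r≤1+k : k + r ≤ suc k
      k+r≤1+k = ≤-trans (+-monoʳ-≤ k r≤1) (≤-reflexive (+-comm k 1))

    -- If the parent f′ of f were a repeat of x, then x would be a repeat of f′; but those lie two levels lower.
    not-parent : ∀ {i a r s e x x′ f f′ k} → (∀ {j} → k ≡ suc j → ClosedUnderRepeats j) → suc k ≤ m →
      Link (m + a) (c i) r → Link (suc m + a) (c i) s → r ≤ 1 → s ≤ 1 →
      Branch i x x′ (suc k) → Branch a f f′ k → OffC e → Rep x e → f′ ≢ e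
    not-parent _ _ _ _ _ _ _ (root eq) off _ refl = off _ (sym eq)
    not-parent {k = suc j} ih k≤m link link′ r≤1 s≤1 bx (up _ _ _ b) off rep refl
      with ih refl (≤-trans (n≤1+n _) (≤-trans (n≤1+n _) k≤m)) b
    ... | record { rep-f = rf ; rep-h = rh ; f≢h = f≢h ; branch-f = bf ; branch-h = bh }
      with repeats-exhausted rf rh f≢h (Rep-sym rep)
    ...   | inj₁ refl = two-levels-apart k≤m r≤1 link bx bf
    ...   | inj₂ refl = two-levels-apart k≤m s≤1 link′ bx bh

    -- Adjacent to the two repeats of the parent of `x` there are repeats of `x`, off C because `x`
    -- is. The hypothesis two levels down is what `not-parent` needs to keep the new branches from
    -- backtracking.
    grow : ∀ k → ClosedUnderRepeats k → (∀ {j} → k ≡ suc j → ClosedUnderRepeats j) →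
           ClosedUnderRepeats (suc k)
    grow k ih ih′ k≤m {i} bx@(up off xx′ _ b)
      with ih (<⇒≤ k≤m) b
    ... | record { rep-f = rf ; rep-h = rh ; f≢h = f≢h ; branch-f = bf ; branch-h = bh }
      with repeat-of-neighbour xx′ rf | repeat-of-neighbour xx′ rh
    ... | u , uf , ru | v , vh , rv = record
      { rep-f    = ru
      ; rep-h    = rv
      ; f≢h      = u≢v
      ; branch-f = bu
      ; branch-h = bv
      }
      where
      offu = repeat-off off ru
      offv = repeat-off off rv
      -- The repeats of `c (m + i)` are `c i` and its predecessor, those of `c (suc m + i)` are
      -- `c i` and its successor; hence links of lengths 1 and 0 to `c i`.
      bu : Branch (m + i) u _ (suc k)
      bu = up offu uf
        (≢-sym (not-parent ih′ k≤m
          (link-forward 1 (full-turn i)) (link-forward 0 (full-turn i)) ≤-refl z≤n bx bf offu ru)) bf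
      bv : Branch (suc m + i) v _ (suc k)
      bv = up offv vh
        (≢-sym (not-parent ih′ k≤m
          (link-forward 0 (full-turn′ i)) (link-backward 1 shifted) z≤n ≤-refl bx bh offv rv)) bh
        where
        shifted : c (suc m + (suc m + i)) ≡ c (1 + i)
        shifted = trans (cong (λ t → c (suc m + t)) (sym (+-suc m i))) (sym (full-turn (suc i)))
      -- Equal heights over adjacent vertices of C would give walks of lengths k + 1 and k + 2 to
      -- `c (m + i)`.
      u≢v : u ≢ v
      u≢v refl = m≢1+m+n (suc k + 0) {0} (trans
        (same-length offu bu here bv (link-backward 1 refl)
          (≤-trans (≤-reflexive (+-identityʳ _)) (m≤n⇒m≤1+n k≤m))
          (≤-trans (≤-reflexive (+-comm (suc k) 1)) (s≤s k≤m)))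
        (trans (+-comm (suc k) 1) (cong suc (trans (sym (+-identityʳ (suc k))) (sym (+-identityʳ (suc k + 0)))))))

    closed-under-repeats : ∀ k → ClosedUnderRepeats k
    closed-under-repeats zero _ {i} (root refl) = record
      { rep-f    = repeat-m i
      ; rep-h    = repeat-m+1 i
      ; f≢h      = ~⇒≢ (adjacent (m + i))
      ; branch-f = root refl
      ; branch-h = root refl
      }
    closed-under-repeats (suc zero)    = grow 0 (closed-under-repeats 0) λ ()
    closed-under-repeats (suc (suc k)) =
      grow (suc k) (closed-under-repeats (suc k)) λ { refl → closed-under-repeats k }

    -- A chord of C would be a second walk of length at most m beside the shorter arc between its
    -- ends.
    off-neighbour : ∃[ y ] c 0 ~ y × OffC y
    -- `c (m + m)` precedes `c 0`, as C has length 2m + 1; the last argument only fills the third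
    -- slot.
    off-neighbour with neighbour-avoiding (c 0) (c 1) (c (m + m)) (c 1)
    ... | y , c₀y , y≢c₁ , y≢c₋₁ , _ = y , c₀y , off
      where
      short : ∀ {r} → r ≢ 1 → r ≤ m → ¬ NB (c 0) (c 0) y r
      short r≢1 r≤m w = length-differ w edge r≢1 (short-walks-unique w edge r≤m (≤-trans (s≤s z≤n) 3≤m))
        where
        edge : NB (c 0) (c 0) y 1
        edge = step c₀y (≢-sym (~⇒≢ c₀y)) []
      off : OffC y
      off j refl with reach 0 j
      ... | t , t<L , same with t ≤? m
      ...   | yes t≤m = short (λ { refl → y≢c₁ (same 0) }) t≤m (forward-free t (same 0))
      ...   | no t≰m = short r≢1 r≤m (backward-free r
        (sym (trans (same r) (trans (cong c (trans (sym (+-assoc r t 0)) (cong (_+ 0) r+t≡L))) (periodic 0)))))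
        where
        r : ℕ
        r = suc (m + m) ∸ t
        r+t≡L : r + t ≡ suc (m + m)
        r+t≡L = m∸n+n≡m (<⇒≤ t<L)
        r≤m : r ≤ m
        r≤m = ≤-trans (∸-monoʳ-≤ (suc (m + m)) (≰⇒> t≰m)) (≤-reflexive (m+n∸m≡n m m))
        r≢1 : r ≢ 1
        r≢1 r≡1 = y≢c₋₁ (trans (same 0) (cong c (trans (+-identityʳ t)
          (suc-injective (trans (cong (_+ t) (sym r≡1)) r+t≡L)))))

    forward-into : ∀ r {i s v z t} → c (suc i) ≢ c s → v ≡ c (r + i) →
                   (∀ s → NB (c s) v z t) → NB (c s) (c i) z (r + t)
    forward-into zero    _  refl w = w _
    forward-into (suc r) {i} ne eq w = step (adjacent i) ne
      (forward-into r {s = i} (turn i) (trans eq (cong c (sym (+-suc r i)))) w)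

    -- Two walks of length D between neighbours of the cycle

    module _ {y g : V} (c₀y : c 0 ~ y) (offy : OffC y) (g~cₘ : g ~ c m) (offg : OffC g) where

      branch-y : Branch 0 y (c 0) 1
      branch-y = up offy (~-sym c₀y) (≢-sym (offy 0)) (root refl)

      branch-g : Branch m g (c m) 1
      branch-g = up offg g~cₘ (≢-sym (offg m)) (root refl)

      cₘ-to-c₀ : Link m (c 0) m
      cₘ-to-c₀ = link-backward m (cong c (sym (+-identityʳ m)))

      c₀-to-cₘ : Link 0 (c m) m
      c₀-to-cₘ = link-forward m (cong c (sym (+-identityʳ m)))

      y≢g : y ≢ g
      y≢g refl = contradiction (≤-trans 3≤m (≤-reflexive (sym (suc-injective
        (same-length offy branch-y here branch-g cₘ-to-c₀ (s≤s z≤n) ≤-refl))))) λ ()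

      -- Together with the route along C through `c m`, of length D, this walk would make `g` a
      -- repeat of `c 0`.
      not-via-c₀ : ∀ {a} → NB y (c 0) g a → a ≤ m → ⊥
      not-via-c₀ w a≤m = repeat-on
        (repeat w long (length-differ w long (<⇒≢ (≤-trans (s≤s a≤m) (≤-reflexive (+-comm 1 m)))))
          (m≤n⇒m≤1+n a≤m) (≤-reflexive (+-comm m 1)))
        offg
        where
        long : NB (c 0) (c 0) g (m + 1)
        long = forward-into m {s = 0} (≢-sym (~⇒≢ (adjacent 0))) (cong c (sym (+-identityʳ m)))
          (λ s → step (~-sym g~cₘ) (≢-sym (offg s)) [])

      -- Otherwise `y` would have a walk of length at most m to `c m` besides the one of length D
      -- through `c 0`.
      not-via-cₘ : ∀ {a} (w : NB (c 0) y g (suc a)) → suc a ≤ suc m → c m ≢ pos w a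
      not-via-cₘ {a} w a<D eq = length-differs eq (init w)
        where
        long : NB y y (c m) (suc m)
        long = to-cycle offy c₀-to-cₘ branch-y
        length-differs : ∀ {x} → c m ≡ x → NB (c 0) y x a → ⊥
        length-differs refl w′ =
          length-differ w′ long (<⇒≢ a<D) (off-unique offy w′ long (<⇒≤ a<D) ≤-refl)

      bridge : ∀ {a} (w : NB (c 0) y g (suc a)) → c m ≢ pos w a → NB (c 0) (c 0) (c m) (3 + a)
      bridge w ne = step c₀y (≢-sym (~⇒≢ c₀y)) (snoc w g~cₘ ne)

      -- If a < m, then `g` has height a + 2 ≤ D over `c 0`. Comparison with the route through `c m`
      -- and along C to `c 0` would make `c m` the parent of `g` in that branch.
      bridge-length : ∀ {a} (w : NB (c 0) y g (suc a)) → c m ≢ pos w a → suc a ≤ suc m → a ≡ m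
      bridge-length {a} w ne a<D with m≤n⇒m<n∨m≡n (s≤s⁻¹ a<D)
      ... | inj₂ a≡m = a≡m
      ... | inj₁ a<m = contradiction
        (same-first branch-g cₘ-to-c₀ g-over-c₀ here ≤-refl (≤-trans (≤-reflexive (+-identityʳ (2 + a))) (s≤s a<m)))
        ne
        where
        b : NB (c 0) (c 0) (c m) (3 + a)
        b = bridge w ne
        g-over-c₀ : Branch 0 g (pos w a) (2 + a)
        g-over-c₀ = subst₂ (λ x x′ → Branch 0 x x′ (2 + a))
          (trans (pos-snoc w g~cₘ ne (suc a) ≤-refl) (pos-end w))
          (pos-snoc w g~cₘ ne a (n≤1+n a))
          (climb (pos-path b) refl offy (2 + a) (s≤s z≤n) (s≤s a<m) (n≤1+n _))

      -- Brings each walk witnessing a repeat into a form that `bridge` can extend at both ends,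
      -- with length exactly D.
      detour : ∀ {a} (w : NB y y g a) → a ≤ suc m →
               Σ (NB (c 0) y g (suc m)) λ w′ → code w′ ≡ code w × c m ≢ pos w′ m
      detour [] _ = ⊥-elim (y≢g refl)
      detour (step {x = x} yx x≢y w) (s≤s a≤m) with x ≟ᶠ c 0
      ... | yes refl = ⊥-elim (not-via-c₀ w a≤m)
      ... | no x≢c₀ with not-via-cₘ (step yx x≢c₀ w) (s≤s a≤m)
      ...   | ne with bridge-length (step yx x≢c₀ w) ne (s≤s a≤m)
      ...     | refl = step yx x≢c₀ w , refl , ne

      module _ (α β : NB (c 0) y g (suc m)) (α≢β : code α ≢ code β)
        (neα : c m ≢ pos α m) (neβ : c m ≢ pos β m) where

        differ-second : ∀ {p p′ u v} (w : NB p u v (suc m)) (w′ : NB p′ u v (suc m)) →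
                        code w ≢ code w′ → pos w 1 ≢ pos w′ 1
        differ-second (step _ _ w) (step _ _ w′) ne refl =
          ne (cong (_ ∷_) (short-walks-unique w w′ ≤-refl ≤-refl))

        differ-penultimate : ∀ {p p′ u v} (w : NB p u v (suc m)) (w′ : NB p′ u v (suc m)) →
                             code w ≢ code w′ → pos w m ≢ pos w′ m
        differ-penultimate {v = v} w w′ ne eq = ne (trans (code-init w)
          (trans (cong (_∷ʳ v) (same eq (init w) (init w′))) (sym (code-init w′))))
          where
          same : ∀ {p p′ u x x′} → x ≡ x′ → (w : NB p u x m) (w′ : NB p′ u x′ m) → code w ≡ code w′
          same refl w w′ = short-walks-unique w w′ ≤-refl ≤-refl

        F H : ℕ → V
        F = pos (bridge α neα)
        H = pos (bridge β neβ)

        path-F : Path (3 + m) F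
        path-F = pos-path (bridge α neα)

        path-H : Path (3 + m) H
        path-H = pos-path (bridge β neβ)

        F≡α : ∀ t → t ≤ suc m → F (suc t) ≡ pos α t
        F≡α = pos-snoc α g~cₘ neα

        H≡β : ∀ t → t ≤ suc m → H (suc t) ≡ pos β t
        H≡β = pos-snoc β g~cₘ neβ

        F-g : F (2 + m) ≡ g
        F-g = trans (F≡α (suc m) ≤-refl) (pos-end α)

        H-g : H (2 + m) ≡ g
        H-g = trans (H≡β (suc m) ≤-refl) (pos-end β)

        1≤m : 1 ≤ m
        1≤m = ≤-trans (s≤s z≤n) 3≤m

        -- Position t of a bridge has height t over `c 0` and m + 3 - t over `c m`, when these lie
        -- between 1 and D. Positions m and 3 thus have heights m and 3, in opposite orders.
        W Z : V
        W = F m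
        Z = H 3

        W-Z : Rep W Z
        W-Z with opposite-walks (m ∸ 2) (sym (m+[n∸m]≡n (≤-trans (s≤s (s≤s z≤n)) 3≤m))) path-F path-H
              refl (trans F-g (sym H-g))
              (λ eq → differ-second α β α≢β
                (trans (sym (F≡α 1 (s≤s z≤n))) (trans eq (H≡β 1 (s≤s z≤n)))))
              (λ eq → differ-penultimate α β α≢β
                (trans (sym (F≡α m (n≤1+n m))) (trans eq (H≡β m (n≤1+n m)))))
        ... | _ , _ , w , w′ , ≤₁ , ≤₂ , ne = 2≤T w w′ ne ≤₁ ≤₂

        W-over-c₀ : Branch 0 W (F (pred m)) m
        W-over-c₀ = climb path-F refl offy m 1≤m (n≤1+n m) (m≤n+m m 3)

        W-over-cₘ : Branch m W (F (suc m)) 3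
        W-over-cₘ = climb (reverse-path path-F) (pos-end (bridge α neα)) (subst OffC (sym F-g) offg)
          3 (s≤s z≤n) (≤-trans 3≤m (n≤1+n m)) (m≤m+n 3 m)

        Z-over-c₀ : Branch 0 Z (H 2) 3
        Z-over-c₀ = climb path-H refl offy 3 (s≤s z≤n) (≤-trans 3≤m (n≤1+n m)) (m≤m+n 3 m)

        Z-over-cₘ : Branch m Z (H (3 + m ∸ pred m)) m
        Z-over-cₘ = subst (λ t → Branch m (H t) (H (3 + m ∸ pred m)) m) (m+n∸n≡m 3 m)
          (climb (reverse-path path-H) (pos-end (bridge β neβ)) (subst OffC (sym H-g) offg)
            m 1≤m (n≤1+n m) (m≤n+m m 3))

        -- The repeats of W are p over c m and q over c (m + 1), at height m; they are also p′ over c (2m)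
        -- and q′ over c (2m + 1) = c 0, at height 3. Since Z = p = q′, the other ones agree: q = p′.
        two-long-walks-absurd : ⊥
        two-long-walks-absurd
          with closed-under-repeats m ≤-refl W-over-c₀ | closed-under-repeats 3 3≤m W-over-cₘ
        ... | record { f = p ; h = q ; h′ = q₁ ; rep-f = rp ; rep-h = rq ; f≢h = p≢q ; branch-f = bp ; branch-h = bq }
            | record { f = p′ ; h = q′ ; rep-f = rp′ ; rep-h = rq′ ; f≢h = p′≢q′ ; branch-f = bp′ ; branch-h = bq′ }
            = conclude (repeats-exhausted rp rq p≢q W-Z) (repeats-exhausted rp rq p≢q rp′)
          where
          over-cₘ₊₁ : Branch (suc m) q q₁ m
          over-cₘ₊₁ = subst (λ i → Branch i q q₁ m) (+-identityʳ (suc m)) bq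
          offZ : OffC Z
          offZ = branch-off (s≤s z≤n) Z-over-c₀
          -- Height m over both `c m` and `c (m + 1)` is impossible, as the walks to `c m` would
          -- have lengths m and m + 1. `Z≢p′` is similar, with height 3 over `c 0` and its
          -- predecessor.
          Z≢q : Z ≢ q
          Z≢q refl = m≢1+m+n m {0} (trans (sym (+-identityʳ m)) (trans
            (same-length offZ Z-over-cₘ here over-cₘ₊₁ (link-backward 1 refl)
              (≤-trans (≤-reflexive (+-identityʳ m)) (n≤1+n m)) (≤-reflexive (+-comm m 1)))
            (trans (+-comm m 1) (cong suc (sym (+-identityʳ m))))))
          Z≢p′ : Z ≢ p′
          Z≢p′ refl = contradiction
            (same-length offZ Z-over-c₀ here bp′
              (link-forward 1 (trans (sym (periodic 0)) (cong c (+-identityʳ (suc (m + m))))))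
              (≤-trans 3≤m (n≤1+n m)) (s≤s 3≤m)) λ ()
          -- Here both walks to `c (m + 2)` have length m + 1, so lengths do not conflict; the roots
          -- do, since `c (m + m)` and `c (suc m)` are m - 1 steps apart.
          p′≢q : p′ ≢ q
          p′≢q refl = distinct (suc m) (pred m) (pred-mono-≤ 2≤m)
            (≤-trans (s≤s pred[n]≤n) (s≤s (m≤m+n m m)))
            (trans (cong c pred[m]+1+m≡m+m)
              (same-root bp′ (link-backward (m ∸ 2) (cong c (sym m∸2+2+m≡m+m)))
                over-cₘ₊₁ (link-forward 1 refl) offq
                (≤-reflexive (cong suc (m+[n∸m]≡n 2≤m))) (≤-reflexive (+-comm m 1))))
            where
            offq : OffC q
            offq = branch-off 1≤m over-cₘ₊₁
            2≤m : 2 ≤ m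
            2≤m = ≤-trans (s≤s (s≤s z≤n)) 3≤m
            m∸2+2+m≡m+m : m ∸ 2 + (2 + m) ≡ m + m
            m∸2+2+m≡m+m = trans (sym (+-assoc (m ∸ 2) 2 m)) (cong (_+ m) (m∸n+n≡m 2≤m))
            pred[m]+1+m≡m+m : pred m + suc m ≡ m + m
            pred[m]+1+m≡m+m = trans (+-suc (pred m) m) (cong (_+ m) (suc-pred m {{>-nonZero 1≤m}}))
          conclude : Z ≡ p ⊎ Z ≡ q → p′ ≡ p ⊎ p′ ≡ q → ⊥
          conclude (inj₂ Z≡q) _           = Z≢q Z≡q
          conclude _          (inj₂ p′≡q) = p′≢q p′≡q
          conclude (inj₁ Z≡p) (inj₁ p′≡p) = Z≢p′ (trans Z≡p (sym p′≡p))

      no-repeat : ¬ Rep y g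
      no-repeat rep with 2≤T⇒two-walks {suc m} rep
      ... | _ , _ , w , w′ , ≤₁ , ≤₂ , w≢w′ with detour w ≤₁ | detour w′ ≤₂
      ...   | α , α≡w , neα | β , β≡w′ , neβ = two-long-walks-absurd α β
        (λ eq → w≢w′ (trans (sym α≡w) (trans eq β≡w′))) neα neβ

    absurd : ⊥
    absurd with off-neighbour
    ... | y , c₀y , offy with closed-under-repeats 1 (≤-trans (s≤s z≤n) 3≤m) (up offy (~-sym c₀y) (≢-sym (offy 0)) (root refl))
    ...   | record { f = g ; rep-f = rep ; branch-f = up offg gx _ (root refl) } =
      no-repeat c₀y offy (subst (λ i → g ~ c i) (+-identityʳ m) gx) offg rep

-- Girth exactly 2D

theorem5p2 : (d D : ℕ) → 4 ≤ d → 4 ≤ D → {n : ℕ} → (Γ : Graph n) →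
    IsDefectGraph d D 2 Γ → Girth Γ (2 * D)
theorem5p2 (suc q) (suc m) (s≤s 3≤q) (s≤s 3≤m) Γ (max-degree , diameter , order) =
  cycle-2D , no-shorter
  where
  open Walks Γ
  open ClosedWalks Γ
  open Circuits Γ
  open DefectTwo Γ q m 3≤q 3≤m max-degree diameter order

  2D≡2+2m : 2 * suc m ≡ 2 + (m + m)
  2D≡2+2m = cong suc (trans (cong (m +_) (+-identityʳ (suc m))) (+-suc m m))

  no-shorter : ∀ k → k < 2 * suc m → ¬ Cycle Γ k
  no-shorter k k<2D cycle with m≤n⇒m<n∨m≡n (s≤s⁻¹ (subst (k <_) 2D≡2+2m k<2D))
  ... | inj₁ (s≤s k≤2m) = no-cycle-≤2m k≤2m cycle
  ... | inj₂ refl = OddCycle.absurd (proj₂ (cycle⇒circuit cycle))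

  cycle-2D : Cycle Γ (2 * suc m)
  -- The two walks of a repeat close up to a cycle of length at most 2D, and `no-shorter` leaves
  -- only equality.
  cycle-2D with repeat-exists (proj₁ (proj₂ max-degree))
  ... | u , v , rep with 2≤T⇒two-walks {suc m} {u} {u} {v} rep
  ...   | a , b , w , w′ , a≤D , b≤D , w≢w′ with two-walks⇒closed-path w w′ w≢w′
  ...     | L , F , L≤ , path with closed-path⇒cycle L F path
  ...       | k , k≤L , cycle = subst (Cycle Γ) (≤-antisym k≤2D (≮⇒≥ λ k<2D → no-shorter k k<2D cycle)) cycle
    where
    k≤2D : k ≤ 2 * suc m
    k≤2D = ≤-trans k≤L (≤-trans L≤ (+-mono-≤ a≤D (subst (b ≤_) (sym (+-identityʳ (suc m))) b≤D)))
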